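{- Consider any instance of the online allocation model with full compatibility and homogeneous bonuses, i.e. $f_i=f$ for all products $i\in\mathcal I$, where $f:\mathbb Z_+\to\mathbb R_+$ is nonnegative and nondecreasing with $f(0)=0$. Let $C=\sum_{i\in\mathcal I}b_i$. Let $\pi^{\mathrm{base}}$ be the fixed-order fill algorithm that orders products in nonincreasing base reward $r_i$, and let $\pi^{\mathrm{cap}}$ be the fixed-order fill algorithm that orders products in nonincreasing capacity $b_i$. Then the one of $\pi^{\mathrm{base}},\pi^{\mathrm{cap}}$ with the larger expected reward can be selected in $O(TC)$ time, and $$\max\left\{\mathbb E\left[\mathrm{Rev}^{\pi^{\mathrm{base}}}\right],\ \mathbb E\left[\mathrm{Rev}^{\pi^{\mathrm{cap}}}\right]\right\}\ \ge\ \frac12\,\mathbb E[U(L)].$$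
   Context: Model. An instance consists of products $\mathcal I=\{1,\dots,m\}$, capacities $b_i\in\mathbb Z_+$ (nonnegative integers), base rewards $r_i\ge 0$, bonus functions $f_i:\mathbb Z_+\to\mathbb R_+$ that are nonnegative and nondecreasing with $f_i(0)=0$, a horizon of $T$ periods and arrival probabilities $p_1,\dots,p_T\in[0,1]$. In period $t$ a customer arrives with probability $p_t$, independently across periods; $L$ is the total number of arrivals. Each arriving customer must be immediately and irrevocably assigned to a product with remaining capacity or rejected; every customer may be assigned to every product (full compatibility). The $k$-th sale of product $i$ yields reward $r_i+f_i(k)$, so $n$ sales yield $R_i(n)=n r_i+\sum_{k=1}^n f_i(k)$, $R_i(0)=0$. An online algorithm $\pi$ (possibly randomized) knows all instance parameters but not future arrivals; $\mathrm{Rev}^\pi$ is its random total reward. Offline benchmark: $U(\ell)=\max\{\sum_{i\in\mathcal I}R_i(x_i): \boldsymbol x\in\mathbb Z_+^m,\ x_i\le b_i\ \forall i,\ \sum_i x_i\le \ell\}$ for $\ell\in\mathbb Z_+$. Fixed-order fill algorithm: given an ordering $\sigma=(\sigma_1,\dots,\sigma_m)$ of the products, each arriving customer is assigned to the first product in the order $\sigma$ that still has remaining capacity; if all products are full the customer is rejected. -}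

module Defs where

open import Algebra.Bundles using (CommutativeRing)
open import Data.Bool.Base using (Bool; true; false; if_then_else_; not; _∧_)
open import Data.Bool.Properties using (T?)
open import Data.Fin.Base as Fin using (Fin; toℕ)
open import Data.Fin.Permutation using (Permutation′; _⟨$⟩ʳ_; _⟨$⟩ˡ_)
open import Data.List.Base as List using (List; []; _∷_; find; upTo; cartesianProductWith)
open import Data.Maybe.Base using (Maybe; maybe′)
open import Data.Nat.Base as ℕ using (ℕ; zero; suc)
import Data.Nat.Properties as ℕ
open import Data.Product.Base using (_×_)
open import Data.Vec.Base as Vec using (Vec; []; _∷_)
open import Data.Vec.Functional as F using (Vector; updateAt)
import Level
open Level using (_⊔_)
open import Relation.Binary.Bundles using (DecTotalOrder)
open import Relation.Binary.Core using (Rel)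
open import Relation.Binary.PropositionalEquality using (_≡_)
open import Relation.Binary.Structures using (IsDecTotalOrder)
open import Relation.Nullary.Decidable.Core using (does)
open import Relation.Nullary.Negation.Core using (¬_)

-- Linearly ordered fields; classically ℝ is one.  The inverse is total, with
-- no constraint on the inverse of zero.
record OrderedField c ℓ₁ ℓ₂ : Set (Level.suc (c ⊔ ℓ₁ ⊔ ℓ₂)) where
  infix 4 _≤_
  field
    commutativeRing : CommutativeRing c ℓ₁
  open CommutativeRing commutativeRing public
  infix 8 _⁻¹
  field
    _≤_             : Rel Carrier ℓ₂
    isDecTotalOrder : IsDecTotalOrder _≈_ _≤_
    +-monoʳ-≤       : ∀ x {y z} → y ≤ z → x + y ≤ x + z
    *-nonneg        : ∀ {x y} → 0# ≤ x → 0# ≤ y → 0# ≤ x * y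
    _⁻¹             : Carrier → Carrier
    ⁻¹-inverseʳ     : ∀ {x} → ¬ x ≈ 0# → x * x ⁻¹ ≈ 1#
    0≉1             : ¬ 0# ≈ 1#

  decTotalOrder : DecTotalOrder c ℓ₁ ℓ₂
  decTotalOrder = record { isDecTotalOrder = isDecTotalOrder }

  open DecTotalOrder decTotalOrder public using (_≤?_; totalOrder)

------------------------------------------------------------------------
-- Programs of a unit-cost random access machine whose memory consists of
-- arrays of natural numbers and arrays of field elements, all indexed by ℕ.
-- An array is named by a number.

data NatExp : Set where
  lit      : ℕ → NatExp
  nat[_,_] : (array : ℕ) (index : NatExp) → NatExp
  _⊕_ _⊖_  : NatExp → NatExp → NatExp   -- ⊖ is truncated

data NumExp : Set where
  `0 `1       : NumExp
  num[_,_]    : (array : ℕ) (index : NatExp) → NumExp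
  _⊞_ _⊟_ _⊠_ : NumExp → NumExp → NumExp

data Test : Set where
  _<ⁿ_  : NatExp → NatExp → Test
  _≤ᵏ_  : NumExp → NumExp → Test
  _and_ : Test → Test → Test
  neg   : Test → Test

data Program : Set where
  skip            : Program
  nat[_,_]:=_     : (array : ℕ) (index : NatExp) → NatExp → Program
  num[_,_]:=_     : (array : ℕ) (index : NatExp) → NumExp → Program
  _⨾_             : Program → Program → Program
  when_run_else_  : Test → Program → Program → Program
  while_run_      : Test → Program → Program

infixr 2 _⨾_
infix  3 nat[_,_]:=_ num[_,_]:=_ when_run_else_ while_run_
infixr 3 _and_
infix  4 _<ⁿ_ _≤ᵏ_
infixl 6 _⊕_ _⊖_ _⊞_ _⊟_
infixl 7 _⊠_

costⁿ : NatExp → ℕ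
costⁿ (lit _)      = 1
costⁿ nat[ _ , e ] = suc (costⁿ e)
costⁿ (d ⊕ e)      = suc (costⁿ d ℕ.+ costⁿ e)
costⁿ (d ⊖ e)      = suc (costⁿ d ℕ.+ costⁿ e)

costᵏ : NumExp → ℕ
costᵏ `0           = 1
costᵏ `1           = 1
costᵏ num[ _ , e ] = suc (costⁿ e)
costᵏ (d ⊞ e)      = suc (costᵏ d ℕ.+ costᵏ e)
costᵏ (d ⊟ e)      = suc (costᵏ d ℕ.+ costᵏ e)
costᵏ (d ⊠ e)      = suc (costᵏ d ℕ.+ costᵏ e)

costᵗ : Test → ℕ
costᵗ (d <ⁿ e)  = suc (costⁿ d ℕ.+ costⁿ e)
costᵗ (d ≤ᵏ e)  = suc (costᵏ d ℕ.+ costᵏ e)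
costᵗ (s and t) = suc (costᵗ s ℕ.+ costᵗ t)
costᵗ (neg t)   = suc (costᵗ t)

write : ∀ {a} {A : Set a} → ℕ → ℕ → A → (ℕ → ℕ → A) → ℕ → ℕ → A
write a j x mem a′ j′ =
  if does (a ℕ.≟ a′) ∧ does (j ℕ.≟ j′) then x else mem a′ j′

extend : ∀ {a} {A : Set a} {n} → A → Vector A n → ℕ → A
extend {n = zero}  z xs j       = z
extend {n = suc n} z xs zero    = F.head xs
extend {n = suc n} z xs (suc j) = extend z (F.tail xs) j

outcomes : ∀ n → List (Vec Bool n)
outcomes zero    = [] ∷ []
outcomes (suc n) = cartesianProductWith _∷_ (true ∷ false ∷ []) (outcomes n)

-- All vectors bounded entrywise by u.
box : ∀ {n} → Vector ℕ n → List (Vector ℕ n)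
box {zero}  u = (λ ()) ∷ []
box {suc n} u = cartesianProductWith F._∷_ (upTo (suc (F.head u))) (box (F.tail u))

------------------------------------------------------------------------

module Model {c ℓ₁ ℓ₂} (K : OrderedField c ℓ₁ ℓ₂) where

  open OrderedField K public
  open import Algebra.Construct.NaturalChoice.Max totalOrder public
    using () renaming (_⊔_ to max)
  open import Algebra.Properties.Semiring.Sum semiring public using (sum)
  open import Algebra.Definitions.RawMonoid +-rawMonoid public
    using () renaming (_×_ to _·_)

  ½ : Carrier
  ½ = (1# + 1#) ⁻¹

  prob : ∀ {n} → Vector Carrier n → Vec Bool n → Carrier
  prob q []      = 1#
  prob q (a ∷ ω) = (if a then F.head q else 1# - F.head q) * prob (F.tail q) ω

  record IsBonus (f : ℕ → Carrier) : Set (ℓ₁ ⊔ ℓ₂) where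
    field
      zero-at-0 : f 0 ≈ 0#
      nonneg    : ∀ k → 0# ≤ f k
      monotone  : ∀ {j k} → j ℕ.≤ k → f j ≤ f k

  record Instance : Set (c ⊔ ℓ₁ ⊔ ℓ₂) where
    field
      m T      : ℕ
      b        : Vector ℕ m
      r        : Vector Carrier m
      f        : Fin m → ℕ → Carrier
      p        : Vector Carrier T
      r-nonneg : ∀ i → 0# ≤ r i
      f-bonus  : ∀ i → IsBonus (f i)
      p-nonneg : ∀ t → 0# ≤ p t
      p≤1      : ∀ t → p t ≤ 1#

  module _ (I : Instance) where
    open Instance I

    Homogeneous : (ℕ → Carrier) → Set ℓ₁
    Homogeneous g = ∀ i k → f i k ≈ g k

    totalCapacity : ℕ
    totalCapacity = F.foldr ℕ._+_ 0 b

    R : Fin m → ℕ → Carrier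
    R i n = (n · r i) + sum {n} (λ k → f i (suc (toℕ k)))

    totalReward : Vector ℕ m → Carrier
    totalReward x = sum (λ i → R i (x i))

    -- ω records, period by period, whether a customer arrives.
    Arrivals : Set
    Arrivals = Vec Bool T

    𝔼 : (Arrivals → Carrier) → Carrier
    𝔼 X = List.foldr _+_ 0# (List.map (λ ω → prob p ω * X ω) (outcomes T))

    L : Arrivals → ℕ
    L = Vec.count T?

    allocations : ℕ → List (Vector ℕ m)
    allocations ℓ = List.filter (λ x → F.foldr ℕ._+_ 0 x ℕ.≤? ℓ) (box b)

    -- The empty allocation is feasible with value 0, so starting the maximum
    -- at 0 does not change it.
    U : ℕ → Carrier
    U ℓ = List.foldr max 0# (List.map totalReward (allocations ℓ))

    -- The product offered to an arriving customer, given the sales so far.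
    Policy : Set
    Policy = Vector ℕ m → Maybe (Fin m)

    serve : Policy → Vector ℕ m → Bool → Vector ℕ m
    serve π x false = x
    serve π x true  = maybe′ (λ i → updateAt x i suc) x (π x)

    sales : Policy → Arrivals → Vector ℕ m
    sales π = Vec.foldl (λ _ → Vector ℕ m) (serve π) (λ _ → 0)

    Rev : Policy → Arrivals → Carrier
    Rev π ω = totalReward (sales π ω)

    -- σ ⟨$⟩ʳ j is the product in position j.
    Ordering : Set
    Ordering = Permutation′ m

    fill : Ordering → Policy
    fill σ x = find (λ i → x i ℕ.<? b i) (List.tabulate (σ ⟨$⟩ʳ_))

    NonincreasingBase : Ordering → Set ℓ₂
    NonincreasingBase σ = ∀ {j k} → j Fin.≤ k → r (σ ⟨$⟩ʳ k) ≤ r (σ ⟨$⟩ʳ j)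

    NonincreasingCapacity : Ordering → Set
    NonincreasingCapacity σ = ∀ {j k} → j Fin.≤ k → b (σ ⟨$⟩ʳ k) ℕ.≤ b (σ ⟨$⟩ʳ j)

    IsBetter : Ordering → Ordering → Ordering → Set ℓ₂
    IsBetter σ τ ρ = 𝔼 (Rev (fill σ)) ≤ 𝔼 (Rev (fill ρ))
                   × 𝔼 (Rev (fill τ)) ≤ 𝔼 (Rev (fill ρ))

  ----------------------------------------------------------------------
  -- Execution

  record Store : Set c where
    constructor store
    field
      nats : ℕ → ℕ → ℕ
      nums : ℕ → ℕ → Carrier
  open Store public

  evalⁿ : Store → NatExp → ℕ
  evalⁿ s (lit n)      = n
  evalⁿ s nat[ a , e ] = nats s a (evalⁿ s e)
  evalⁿ s (d ⊕ e)      = evalⁿ s d ℕ.+ evalⁿ s e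
  evalⁿ s (d ⊖ e)      = evalⁿ s d ℕ.∸ evalⁿ s e

  evalᵏ : Store → NumExp → Carrier
  evalᵏ s `0           = 0#
  evalᵏ s `1           = 1#
  evalᵏ s num[ a , e ] = nums s a (evalⁿ s e)
  evalᵏ s (d ⊞ e)      = evalᵏ s d + evalᵏ s e
  evalᵏ s (d ⊟ e)      = evalᵏ s d - evalᵏ s e
  evalᵏ s (d ⊠ e)      = evalᵏ s d * evalᵏ s e

  evalᵗ : Store → Test → Bool
  evalᵗ s (d <ⁿ e)  = does (evalⁿ s d ℕ.<? evalⁿ s e)
  evalᵗ s (d ≤ᵏ e)  = does (evalᵏ s d ≤? evalᵏ s e)
  evalᵗ s (t and u) = evalᵗ s t ∧ evalᵗ s u
  evalᵗ s (neg t)   = not (evalᵗ s t)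

  -- ⟨ P , s ⟩⇓⟨ s′ , n ⟩: started in s, P halts in s′ after n steps.
  data ⟨_,_⟩⇓⟨_,_⟩ : Program → Store → Store → ℕ → Set c where
    skip : ∀ {s} → ⟨ skip , s ⟩⇓⟨ s , 1 ⟩

    assignⁿ : ∀ {s a d e} →
      ⟨ nat[ a , d ]:= e , s ⟩⇓⟨
        store (write a (evalⁿ s d) (evalⁿ s e) (nats s)) (nums s) ,
        suc (costⁿ d ℕ.+ costⁿ e) ⟩

    assignᵏ : ∀ {s a d e} →
      ⟨ num[ a , d ]:= e , s ⟩⇓⟨
        store (nats s) (write a (evalⁿ s d) (evalᵏ s e) (nums s)) ,
        suc (costⁿ d ℕ.+ costᵏ e) ⟩

    seq : ∀ {P Q s s′ s″ n n′} →
      ⟨ P , s ⟩⇓⟨ s′ , n ⟩ → ⟨ Q , s′ ⟩⇓⟨ s″ , n′ ⟩ →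
      ⟨ P ⨾ Q , s ⟩⇓⟨ s″ , n ℕ.+ n′ ⟩

    when-true : ∀ {t P Q s s′ n} → evalᵗ s t ≡ true →
      ⟨ P , s ⟩⇓⟨ s′ , n ⟩ →
      ⟨ when t run P else Q , s ⟩⇓⟨ s′ , suc (costᵗ t ℕ.+ n) ⟩

    when-false : ∀ {t P Q s s′ n} → evalᵗ s t ≡ false →
      ⟨ Q , s ⟩⇓⟨ s′ , n ⟩ →
      ⟨ when t run P else Q , s ⟩⇓⟨ s′ , suc (costᵗ t ℕ.+ n) ⟩

    while-true : ∀ {t P s s′ s″ n n′} → evalᵗ s t ≡ true →
      ⟨ P , s ⟩⇓⟨ s′ , n ⟩ → ⟨ while t run P , s′ ⟩⇓⟨ s″ , n′ ⟩ →
      ⟨ while t run P , s ⟩⇓⟨ s″ , suc (costᵗ t ℕ.+ (n ℕ.+ n′)) ⟩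

    while-false : ∀ {t P s} → evalᵗ s t ≡ false →
      ⟨ while t run P , s ⟩⇓⟨ s , suc (costᵗ t) ⟩

  -- An ordering is presented by two arrays, listing the product in each
  -- position and the position of each product: since capacities may be 0, m
  -- need not be O(T C), so the second cannot in general be computed from the
  -- first within the time bound.  The total capacity is not part of the input.
  input : (I : Instance) → (ℕ → Carrier) → (base cap : Ordering I) → Store
  input I g base cap = store natInput numInput
    where
    open Instance I

    positions products : Ordering I → ℕ → ℕ
    products  σ = extend 0 (λ j → toℕ (σ ⟨$⟩ʳ j))
    positions σ = extend 0 (λ i → toℕ (σ ⟨$⟩ˡ i))

    natInput : ℕ → ℕ → ℕ
    natInput 0 0 = m
    natInput 0 1 = T
    natInput 1 j = extend 0 b j
    natInput 2 j = products base j
    natInput 3 j = positions base j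
    natInput 4 j = products cap j
    natInput 5 j = positions cap j
    natInput _ _ = 0

    numInput : ℕ → ℕ → Carrier
    numInput 0 j = extend 0# r j
    numInput 1 j = g j
    numInput 2 j = extend 0# p j
    numInput _ _ = 0#

  -- The answer is read from cell 0 of natural-number array 0.
  selected : (I : Instance) → (base cap : Ordering I) → Store → Ordering I
  selected I base cap s with nats s 0 0
  ... | zero  = base
  ... | suc _ = cap

  -- One additive constant absorbs the degenerate case T C = 0; for T C ≥ 1
  -- the bound is at most 2 k (T C).
  SelectsWithin : Program → ℕ → (I : Instance) → (ℕ → Carrier) →
                  (base cap : Ordering I) → Store → ℕ → Set (c ⊔ ℓ₂)
  SelectsWithin P k I g base cap s n =
      ⟨ P , input I g base cap ⟩⇓⟨ s , n ⟩
    × n ℕ.≤ k ℕ.* suc (Instance.T I ℕ.* totalCapacity I)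
    × IsBetter I base cap (selected I base cap s)

{-# OPTIONS --safe #-}

-- For every number of arrivals the offline optimum is at most the sum of the
-- two rewards: filling by base reward maximises the linear part n r_i of the
-- objective, filling by capacity maximises its convex part Σ_{k ≤ n} f(k), and
-- both follow from the exchange argument that moving units to the front of the
-- order never loses.  The better order then earns at least half.
--
-- To compare the two in time O(T C), note that the sales of a fill algorithm
-- depend only on the number j of arrivals so far.  Its cumulative rewards S(j)
-- for j ≤ min(T, C) are found by simulating it, where each sale scans only the
-- at most C products of positive capacity, and its expected reward is V(0, 0),
-- where V(T, j) = S(j) and V(t, j) = p V(t+1, j+1) + (1 - p) V(t+1, j) with
-- p the arrival probability of that period.
module Submission where

open import Algebra.Bundles using (CommutativeMonoid)
open import Data.Bool.Base using (Bool; true; false; if_then_else_)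
open import Data.Bool.Properties using (T?)
open import Data.Fin.Base as Fin using (Fin; zero; suc; toℕ; fromℕ<)
open import Data.Fin.Permutation using (Permutation′; _⟨$⟩ʳ_; _⟨$⟩ˡ_; inverseˡ; inverseʳ)
import Data.Fin.Properties as Fin
open import Data.List.Base as List using (List; []; _∷_; _++_; find)
open import Data.List.Membership.Propositional using (_∈_)
open import Data.List.Membership.Propositional.Properties
  using (∈-cartesianProductWith⁻; ∈-upTo⁻; ∈-filter⁻)
open import Data.List.Relation.Unary.Any using (here; there)
open import Data.Maybe.Base using (just; nothing; maybe′)
open import Data.Nat.Base as ℕ using (ℕ; zero; suc; z≤n; s≤s)
import Data.Nat.Properties as ℕ
open import Data.Product.Base using (_×_; _,_; ∃-syntax; proj₁)
open import Data.Sum.Base using (_⊎_; inj₁; inj₂; [_,_]′)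
open import Data.Vec.Base as Vec using (Vec; []; _∷_)
open import Data.Vec.Functional as F using (Vector; updateAt; head; tail)
import Data.Vec.Functional.Properties as F
open import Function.Base using (_∘_)
open import Level using (Lift; lift; lower; _⊔_)
open import Relation.Binary.Bundles using (DecTotalOrder)
open import Relation.Binary.PropositionalEquality as ≡ using (_≡_; _≢_; _≗_)
open import Relation.Nullary using (¬_; Reflects; ofʸ; ofⁿ; yes; no; contradiction; proof)
open import Relation.Nullary.Decidable using (dec-true; dec-false)
open import Relation.Nullary.Reflects using (_×-reflects_; ¬-reflects)
open import Relation.Unary using (Pred; Decidable)
open import Algebra.Properties.CommutativeMonoid.Sum ℕ.+-0-commutativeMonoid
  using () renaming (sum to total; sum-permute to total-permute)
open import Defs

-- The link between the online process and the exchange argument is a closed form for the sales: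
-- listed by position in the order, the sales after ℓ arrivals are `fillUp b ℓ`. Optimality is
-- proved for this vector, and the policy is shown to produce it. The time bound has two obstacles.
-- A table over all j up to T would take about T * T updates. The sweep therefore keeps only the
-- entries up to n, the number of sales simulated, which is at most both T and C. Entry n is never
-- recomputed: on the states that can occur its value does not change from period to period. The
-- second obstacle is T C = 0: with no capacity a simulation still has to discover that nothing can
-- be sold, and a sweep over empty rows would already take T steps. The cost is therefore measured
-- against 1 + T C. Correctness of the program rests on the numbering of the arrays: whatever a
-- piece of code writes has a number at least some threshold, so everything below that threshold is
-- known to survive it.

fillUp : ∀ {m} → Vector ℕ m → ℕ → Vector ℕ m
fillUp b ℓ zero    = ℓ ℕ.⊓ head b
fillUp b ℓ (suc i) = fillUp (tail b) (ℓ ℕ.∸ head b) i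

fillUp≤ : ∀ {m} (b : Vector ℕ m) ℓ i → fillUp b ℓ i ℕ.≤ b i
fillUp≤ b ℓ zero    = ℕ.m⊓n≤n ℓ (head b)
fillUp≤ b ℓ (suc i) = fillUp≤ (tail b) (ℓ ℕ.∸ head b) i

fillUp-0 : ∀ {m} (b : Vector ℕ m) i → fillUp b 0 i ≡ 0
fillUp-0 b zero    = ≡.refl
fillUp-0 b (suc i) rewrite ℕ.0∸n≡0 (head b) = fillUp-0 (tail b) i

-- If the head has room then it is the first open position, and the tail receives nothing before and
-- after. If the head is full it stays so, and the supply passed to the tail grows by one.
fillUp-first : ∀ {m} (b : Vector ℕ m) ℓ {j} → fillUp b ℓ j ℕ.< b j →
               (∀ {i} → i Fin.< j → ¬ fillUp b ℓ i ℕ.< b i) →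
               fillUp b (suc ℓ) ≗ updateAt (fillUp b ℓ) j suc
fillUp-first {suc m} b ℓ {zero} open₀ _ i with ℕ.<-≤-connex ℓ (head b)
... | inj₂ b≤ℓ = contradiction (≡.subst (ℕ._< head b) (ℕ.m≥n⇒m⊓n≡n b≤ℓ) open₀) (ℕ.<-irrefl ≡.refl)
... | inj₁ ℓ<b with i
...   | zero  = ≡.trans (ℕ.m≤n⇒m⊓n≡m ℓ<b) (≡.cong suc (≡.sym (ℕ.m≤n⇒m⊓n≡m (ℕ.<⇒≤ ℓ<b))))
...   | suc i = ≡.cong (λ d → fillUp (tail b) d i)
                  (≡.trans (ℕ.m≤n⇒m∸n≡0 ℓ<b) (≡.sym (ℕ.m≤n⇒m∸n≡0 (ℕ.<⇒≤ ℓ<b))))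
fillUp-first {suc m} b ℓ {suc j} open₀ closed i with ℕ.<-≤-connex ℓ (head b)
... | inj₁ ℓ<b = contradiction (≡.subst (ℕ._< head b) (≡.sym (ℕ.m≤n⇒m⊓n≡m (ℕ.<⇒≤ ℓ<b))) ℓ<b)
                   (closed {zero} (s≤s z≤n))
... | inj₂ b≤ℓ with i
...   | zero  = ≡.trans (ℕ.m≥n⇒m⊓n≡n (ℕ.m≤n⇒m≤1+n b≤ℓ)) (≡.sym (ℕ.m≥n⇒m⊓n≡n b≤ℓ))
...   | suc i = ≡.trans (≡.cong (λ d → fillUp (tail b) d i) (ℕ.+-∸-assoc 1 b≤ℓ))
                  (fillUp-first (tail b) (ℓ ℕ.∸ head b) open₀ (closed ∘ s≤s) i)

fillUp-full : ∀ {m} (b : Vector ℕ m) ℓ → (∀ i → ¬ fillUp b ℓ i ℕ.< b i) →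
              fillUp b (suc ℓ) ≗ fillUp b ℓ
fillUp-full {suc m} b ℓ closed i with ℕ.<-≤-connex ℓ (head b)
... | inj₁ ℓ<b = contradiction (≡.subst (ℕ._< head b) (≡.sym (ℕ.m≤n⇒m⊓n≡m (ℕ.<⇒≤ ℓ<b))) ℓ<b)
                   (closed zero)
... | inj₂ b≤ℓ with i
...   | zero  = ≡.trans (ℕ.m≥n⇒m⊓n≡n (ℕ.m≤n⇒m≤1+n b≤ℓ)) (≡.sym (ℕ.m≥n⇒m⊓n≡n b≤ℓ))
...   | suc i = ≡.trans (≡.cong (λ d → fillUp (tail b) d i) (ℕ.+-∸-assoc 1 b≤ℓ))
                  (fillUp-full (tail b) (ℓ ℕ.∸ head b) (closed ∘ suc) i)

find-tabulate : ∀ {a p} {A : Set a} {P : Pred A p} (P? : Decidable P) {n} (g : Fin n → A) →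
  ((∀ j → ¬ P (g j)) × find P? (List.tabulate g) ≡ nothing)
  ⊎ (∃[ j ] P (g j) × (∀ {i} → i Fin.< j → ¬ P (g i)) × find P? (List.tabulate g) ≡ just (g j))
find-tabulate P? {zero}  g = inj₁ ((λ ()) , ≡.refl)
find-tabulate P? {suc n} g with P? (g zero)
... | yes P₀ = inj₂ (zero , P₀ , (λ ()) , ≡.refl)
... | no ¬P₀ with find-tabulate P? (g ∘ suc)
...   | inj₁ (none , eq) = inj₁ ((λ { zero → ¬P₀ ; (suc j) → none j }) , eq)
...   | inj₂ (j , Pj , first , eq) =
  inj₂ (suc j , Pj , (λ { {zero} _ → ¬P₀ ; {suc i} (s≤s i<j) → first i<j }) , eq)

total-mono : ∀ {m} {x y : Vector ℕ m} → (∀ i → x i ℕ.≤ y i) → total x ℕ.≤ total y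
total-mono {zero}  x≤y = z≤n
total-mono {suc m} x≤y = ℕ.+-mono-≤ (x≤y zero) (total-mono (x≤y ∘ suc))

total-updateAt : ∀ {m} (x : Vector ℕ m) i → total (updateAt x i suc) ≡ suc (total x)
total-updateAt x zero    = ≡.refl
total-updateAt x (suc i) = ≡.trans (≡.cong (head x ℕ.+_) (total-updateAt (tail x) i)) (ℕ.+-suc (head x) _)

-- Each position up to k contributes at least one unit. This bounds the number of products visited
-- by a scan by the total capacity.
positive-prefix : ∀ {m} (v : Vector ℕ m) (k : Fin m) → (∀ {j} → j Fin.≤ k → 0 ℕ.< v j) → toℕ k ℕ.< total v
positive-prefix v zero    pos = ℕ.≤-trans (pos z≤n) (ℕ.m≤m+n _ _)
positive-prefix v (suc k) pos = ℕ.+-mono-≤ (pos {zero} z≤n) (positive-prefix (tail v) k (pos ∘ s≤s))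

-- With g an ordering, this turns the sale of a product into a sale at its position, where `fillUp`
-- lives.
updateAt-∘ : ∀ {m n} (x : Vector ℕ n) (g : Fin m → Fin n) → (∀ {i j} → g i ≡ g j → i ≡ j) →
             ∀ j → updateAt x (g j) suc ∘ g ≗ updateAt (x ∘ g) j suc
updateAt-∘ x g inj j i with i Fin.≟ j
... | yes ≡.refl = ≡.trans (F.updateAt-updates (g i) x) (≡.sym (F.updateAt-updates i (x ∘ g)))
... | no i≢j     = ≡.trans (F.updateAt-minimal (g i) (g j) x (i≢j ∘ inj))
                           (≡.sym (F.updateAt-minimal i j (x ∘ g) i≢j))

perm-injective : ∀ {m} (σ : Permutation′ m) {i j} → σ ⟨$⟩ʳ i ≡ σ ⟨$⟩ʳ j → i ≡ j
perm-injective σ eq = ≡.trans (≡.sym (inverseˡ σ)) (≡.trans (≡.cong (σ ⟨$⟩ˡ_) eq) (inverseˡ σ))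

-- Overflowing a vessel of size B twice is the same as overflowing it once.
⊓-overflow : ∀ u s B → (u ℕ.⊓ B ℕ.+ s) ℕ.⊓ B ≡ (u ℕ.+ s) ℕ.⊓ B
⊓-overflow u s B with ℕ.≤-total u B
... | inj₁ u≤B rewrite ℕ.m≤n⇒m⊓n≡m u≤B = ≡.refl
... | inj₂ B≤u rewrite ℕ.m≥n⇒m⊓n≡n B≤u =
  ≡.trans (ℕ.m≥n⇒m⊓n≡n (ℕ.m≤m+n B s)) (≡.sym (ℕ.m≥n⇒m⊓n≡n (ℕ.≤-trans B≤u (ℕ.m≤m+n u s))))

∸-overflow : ∀ u s B → (u ℕ.∸ B) ℕ.+ ((u ℕ.⊓ B ℕ.+ s) ℕ.∸ B) ≡ (u ℕ.+ s) ℕ.∸ B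
∸-overflow u s B with ℕ.≤-total u B
... | inj₁ u≤B rewrite ℕ.m≤n⇒m⊓n≡m u≤B | ℕ.m≤n⇒m∸n≡0 u≤B = ≡.refl
... | inj₂ B≤u rewrite ℕ.m≥n⇒m⊓n≡n B≤u | ℕ.m+n∸m≡n B s = ≡.sym (ℕ.+-∸-comm s B≤u)

extend-toℕ : ∀ {a} {A : Set a} {n} (z : A) (xs : Vector A n) i → extend z xs (toℕ i) ≡ xs i
extend-toℕ z xs zero    = ≡.refl
extend-toℕ z xs (suc i) = extend-toℕ z (tail xs) i

module _ {ℓ} {A : Set ℓ} where

  write-same : ∀ a j (x : A) mem → write a j x mem a j ≡ x
  write-same a j x mem
    rewrite dec-true (a ℕ.≟ a) ≡.refl | dec-true (j ℕ.≟ j) ≡.refl = ≡.refl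

  write-array : ∀ {a a′} j (x : A) mem j′ → a ≢ a′ → write a j x mem a′ j′ ≡ mem a′ j′
  write-array {a} {a′} j x mem j′ a≢a′ rewrite dec-false (a ℕ.≟ a′) a≢a′ = ≡.refl

  write-index : ∀ a {j j′} (x : A) mem → j ≢ j′ → write a j x mem a j′ ≡ mem a j′
  write-index a {j} {j′} x mem j≢j′
    rewrite dec-true (a ℕ.≟ a) ≡.refl | dec-false (j ℕ.≟ j′) j≢j′ = ≡.refl

updateAt-cong-≗ : ∀ {m} {x y : Vector ℕ m} → x ≗ y → ∀ j → updateAt x j suc ≗ updateAt y j suc
updateAt-cong-≗ x≗y zero    zero    = ≡.cong suc (x≗y zero)
updateAt-cong-≗ x≗y zero    (suc i) = x≗y (suc i)
updateAt-cong-≗ x≗y (suc j) zero    = x≗y zero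
updateAt-cong-≗ x≗y (suc j) (suc i) = updateAt-cong-≗ (x≗y ∘ suc) j i

-- The selection program

-- Arrays 0 to 5 of natural numbers and 0 to 2 of field elements hold the input.
-- Cell 0 of each of the arrays 8 to 11 is a scalar: the number n of sales
-- simulated, the current period t, a loop counter k and the best position q
-- found.  The programs take as parameters the arrays P of positions and Q of
-- products of the order evaluated, the array X counting the sales of each
-- product, and the array V holding cumulative rewards and then expected rewards.
`k `q `i : NatExp
`k = nat[ 10 , lit 0 ]
`q = nat[ 11 , lit 0 ]
`i = nat[ 4 , `k ]

-- The scan follows the capacity order even when another order is evaluated:
-- there the products of positive capacity come first, so it makes at most C steps.
scanGuard : Test
scanGuard = `k <ⁿ nat[ 0 , lit 0 ] and lit 0 <ⁿ nat[ 1 , `i ]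

scanTest : (P X : ℕ) → Test
scanTest P X = nat[ X , `i ] <ⁿ nat[ 1 , `i ] and nat[ P , `i ] <ⁿ `q

scanBody : (P X : ℕ) → Program
scanBody P X =
  when scanTest P X run (nat[ 11 , lit 0 ]:= nat[ P , `i ]) else skip ⨾
  nat[ 10 , lit 0 ]:= lit 1 ⊕ `k

scan : (P X : ℕ) → Program
scan P X =
  -- The number of products stands for "none found": it exceeds every genuine position.
  nat[ 11 , lit 0 ]:= nat[ 0 , lit 0 ] ⨾
  nat[ 10 , lit 0 ]:= lit 0 ⨾
  while scanGuard run scanBody P X

`n : NatExp
`n = nat[ 8 , lit 0 ]

sell : (Q X V : ℕ) → Program
sell Q X V =
  num[ V , lit 1 ⊕ `n ]:= num[ V , `n ] ⊞ (num[ 0 , `s ] ⊞ num[ 1 , lit 1 ⊕ nat[ X , `s ] ]) ⨾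
  nat[ X , `s ]:= lit 1 ⊕ nat[ X , `s ] ⨾
  nat[ 8 , lit 0 ]:= lit 1 ⊕ `n
  where
  `s = nat[ Q , `q ]

foundTest simulateGuard : Test
foundTest     = `q <ⁿ nat[ 0 , lit 0 ]
simulateGuard = `n <ⁿ nat[ 0 , lit 1 ] and foundTest

simulateBody simulate : (P Q X V : ℕ) → Program
simulateBody P Q X V = scan P X ⨾ when foundTest run sell Q X V else skip
simulate P Q X V =
  nat[ 8 , lit 0 ]:= lit 0 ⨾
  -- Position 0 passes the first loop test exactly when there is a product at all.
  nat[ 11 , lit 0 ]:= lit 0 ⨾
  num[ V , lit 0 ]:= `0 ⨾
  while simulateGuard run simulateBody P Q X V

`t : NatExp
`t = nat[ 9 , lit 0 ]

-- The test on n keeps the cost constant when T C = 0.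
updateEntry sweepPeriod sweep : (V : ℕ) → Program
updateEntry V =
  -- Going upwards in k, entry k + 1 still belongs to the following period when it is read, so one
  -- array suffices.
  num[ V , `k ]:= num[ 2 , `t ] ⊠ num[ V , lit 1 ⊕ `k ] ⊞ (`1 ⊟ num[ 2 , `t ]) ⊠ num[ V , `k ] ⨾
  nat[ 10 , lit 0 ]:= lit 1 ⊕ `k
sweepPeriod V =
  nat[ 9 , lit 0 ]:= `t ⊖ lit 1 ⨾
  nat[ 10 , lit 0 ]:= lit 0 ⨾
  while `k <ⁿ `n run updateEntry V
sweep V =
  when lit 0 <ⁿ `n run (
    nat[ 9 , lit 0 ]:= nat[ 0 , lit 1 ] ⨾
    while lit 0 <ⁿ `t run sweepPeriod V) else skip

evaluate : (P Q X V : ℕ) → Program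
evaluate P Q X V = simulate P Q X V ⨾ sweep V

-- An evaluation preserves the natural-number arrays below its X and the field arrays below its V.
-- Taking X = 7 before X = 6 leaves the second set of counters at zero; taking V = 3 before V = 4
-- keeps the first result.
select : Program
select =
  evaluate 3 2 7 3 ⨾
  evaluate 5 4 6 4 ⨾
  when num[ 4 , lit 0 ] ≤ᵏ num[ 3 , lit 0 ]
    run (nat[ 0 , lit 0 ]:= lit 0) else (nat[ 0 , lit 0 ]:= lit 1)

-- Cost arithmetic

-- The additive 1 on the right pays for C = 0, where a single failed search remains; for C at least
-- 1 the factor 2 absorbs 1 + C into 2 C.
simulate-cost : ∀ T C → (T ℕ.⊓ suc C) ℕ.* suc C ℕ.≤ 2 ℕ.* suc (T ℕ.* C)
simulate-cost zero    C         = z≤n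
simulate-cost (suc T) zero      = ℕ.≤-trans (ℕ.*-monoˡ-≤ 1 (ℕ.m⊓n≤n (suc T) 1)) (s≤s z≤n)
simulate-cost T       C@(suc _) = begin
  (T ℕ.⊓ suc C) ℕ.* suc C ≤⟨ ℕ.*-mono-≤ (ℕ.m⊓n≤m T (suc C)) (ℕ.+-monoˡ-≤ C (s≤s z≤n)) ⟩
  T ℕ.* (C ℕ.+ C)         ≡⟨ ℕ.*-distribˡ-+ T C C ⟩
  T ℕ.* C ℕ.+ T ℕ.* C     ≤⟨ ℕ.+-mono-≤ (ℕ.n≤1+n _)
                               (ℕ.≤-trans (ℕ.n≤1+n _) (ℕ.≤-reflexive (≡.sym (ℕ.+-identityʳ _)))) ⟩
  2 ℕ.* suc (T ℕ.* C)     ∎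
  where open ℕ.≤-Reasoning

-- 239 = 21 + 150 + 14 + 54. The 150 is 2 * 75: the 43 steps per scanned product are raised to 75,
-- so that a simulated sale costs at most 75 (1 + C), and `simulate-cost` supplies the 2.
evaluate-cost : ∀ T C {n} → n ℕ.≤ C →
  (21 ℕ.+ (T ℕ.⊓ suc C) ℕ.* (75 ℕ.+ C ℕ.* 43)) ℕ.+ (14 ℕ.+ T ℕ.* (n ℕ.* 54)) ℕ.≤ suc (T ℕ.* C) ℕ.* 239
evaluate-cost T C {n} n≤C = begin
  (21 ℕ.+ M ℕ.* (75 ℕ.+ C ℕ.* 43)) ℕ.+ (14 ℕ.+ T ℕ.* (n ℕ.* 54))
    ≤⟨ ℕ.+-mono-≤ (ℕ.+-mono-≤ (const 21) simulating) (ℕ.+-mono-≤ (const 14) sweeping) ⟩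
  (21 ℕ.* W ℕ.+ 150 ℕ.* W) ℕ.+ (14 ℕ.* W ℕ.+ 54 ℕ.* W)
    ≡⟨ ≡.cong₂ ℕ._+_ (ℕ.*-distribʳ-+ W 21 150) (ℕ.*-distribʳ-+ W 14 54) ⟨
  171 ℕ.* W ℕ.+ 68 ℕ.* W
    ≡⟨ ℕ.*-distribʳ-+ W 171 68 ⟨
  239 ℕ.* W
    ≡⟨ ℕ.*-comm 239 W ⟩
  W ℕ.* 239 ∎
  where
  open ℕ.≤-Reasoning
  M W : ℕ
  M = T ℕ.⊓ suc C
  W = suc (T ℕ.* C)
  const : ∀ a → a ℕ.≤ a ℕ.* W
  const a = ℕ.m≤m*n a W
  simulating : M ℕ.* (75 ℕ.+ C ℕ.* 43) ℕ.≤ 150 ℕ.* W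
  simulating = begin
    M ℕ.* (75 ℕ.+ C ℕ.* 43) ≤⟨ ℕ.*-monoʳ-≤ M (ℕ.+-monoʳ-≤ 75 (ℕ.*-monoʳ-≤ C (ℕ.m≤m+n 43 32))) ⟩
    M ℕ.* (suc C ℕ.* 75)    ≡⟨ ℕ.*-assoc M (suc C) 75 ⟨
    M ℕ.* suc C ℕ.* 75      ≤⟨ ℕ.*-monoˡ-≤ 75 (simulate-cost T C) ⟩
    2 ℕ.* W ℕ.* 75          ≡⟨ ℕ.*-comm (2 ℕ.* W) 75 ⟩
    75 ℕ.* (2 ℕ.* W)        ≡⟨ ℕ.*-assoc 75 2 W ⟨
    150 ℕ.* W               ∎
  sweeping : T ℕ.* (n ℕ.* 54) ℕ.≤ 54 ℕ.* W
  sweeping = begin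
    T ℕ.* (n ℕ.* 54)  ≤⟨ ℕ.*-monoʳ-≤ T (ℕ.*-monoˡ-≤ 54 n≤C) ⟩
    T ℕ.* (C ℕ.* 54)  ≡⟨ ℕ.*-assoc T C 54 ⟨
    T ℕ.* C ℕ.* 54    ≡⟨ ℕ.*-comm (T ℕ.* C) 54 ⟩
    54 ℕ.* (T ℕ.* C)  ≤⟨ ℕ.*-monoʳ-≤ 54 (ℕ.n≤1+n (T ℕ.* C)) ⟩
    54 ℕ.* W          ∎

-- 487 = 2 * 239 + 9, where the 9 pays for the final comparison and the branch taken.
select-cost : ∀ W → suc W ℕ.* 239 ℕ.+ (suc W ℕ.* 239 ℕ.+ 9) ℕ.≤ 487 ℕ.* suc W
select-cost W = begin
  V ℕ.* 239 ℕ.+ (V ℕ.* 239 ℕ.+ 9)       ≤⟨ ℕ.+-monoʳ-≤ (V ℕ.* 239) (ℕ.+-monoʳ-≤ (V ℕ.* 239) (ℕ.m≤n*m 9 V)) ⟩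
  V ℕ.* 239 ℕ.+ (V ℕ.* 239 ℕ.+ V ℕ.* 9) ≡⟨ ≡.cong (V ℕ.* 239 ℕ.+_) (ℕ.*-distribˡ-+ V 239 9) ⟨
  V ℕ.* 239 ℕ.+ V ℕ.* 248               ≡⟨ ℕ.*-distribˡ-+ V 239 248 ⟨
  V ℕ.* 487                             ≡⟨ ℕ.*-comm V 487 ⟩
  487 ℕ.* V                             ∎
  where
  open ℕ.≤-Reasoning
  V : ℕ
  V = suc W

module _ {c ℓ₁ ℓ₂} (K : OrderedField c ℓ₁ ℓ₂) where

  open Model K hiding (zero)
  open DecTotalOrder decTotalOrder using (poset)
    renaming (refl to ≤-refl; reflexive to ≤-reflexive; trans to ≤-trans;
              total to ≤-total; antisym to ≤-antisym)
  open import Algebra.Properties.Semiring.Sum semiring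
    using (sum-cong-≋; sum-permute; sum-init-last; sum-replicate-zero; ∑-distrib-+)
  open import Algebra.Properties.Monoid.Mult +-monoid using (×-homo-+; ×-congˡ)
  open import Algebra.Properties.CommutativeSemigroup
    (CommutativeMonoid.commutativeSemigroup +-commutativeMonoid)
    using (interchange; x∙yz≈y∙xz; xy∙z≈xz∙y)
  open import Algebra.Construct.NaturalChoice.Max totalOrder
    using () renaming (⊔-lub to max-lub; x≤x⊔y to x≤max; x≤y⊔x to y≤max)
  open import Algebra.Properties.Ring ring using (-‿distribˡ-*; -‿involutive)
  open import Relation.Binary.Reasoning.PartialOrder poset

  -- Arithmetic in an ordered field

  +-mono-≤ : ∀ {w x y z} → w ≤ x → y ≤ z → w + y ≤ x + z
  +-mono-≤ {w} {x} {y} {z} w≤x y≤z = begin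
    w + y ≤⟨ +-monoʳ-≤ w y≤z ⟩
    w + z ≈⟨ +-comm w z ⟩
    z + w ≤⟨ +-monoʳ-≤ z w≤x ⟩
    z + x ≈⟨ +-comm z x ⟩
    x + z ∎

  +-nonneg : ∀ {x y} → 0# ≤ x → 0# ≤ y → 0# ≤ x + y
  +-nonneg 0≤x 0≤y = ≤-trans (≤-reflexive (sym (+-identityˡ 0#))) (+-mono-≤ 0≤x 0≤y)

  x≤x+y : ∀ {x y} → 0# ≤ y → x ≤ x + y
  x≤x+y {x} {y} 0≤y = begin
    x      ≈⟨ +-identityʳ x ⟨
    x + 0# ≤⟨ +-monoʳ-≤ x 0≤y ⟩
    x + y  ∎

  x≤y+x : ∀ {x y} → 0# ≤ y → x ≤ y + x
  x≤y+x {x} {y} 0≤y = ≤-trans (x≤x+y 0≤y) (≤-reflexive (+-comm x y))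

  0≤y-x : ∀ {x y} → x ≤ y → 0# ≤ y - x
  0≤y-x {x} {y} x≤y = begin
    0#     ≈⟨ -‿inverseʳ x ⟨
    x - x  ≤⟨ +-mono-≤ x≤y ≤-refl ⟩
    y - x  ∎

  *-monoʳ-≤ : ∀ {x y z} → 0# ≤ x → y ≤ z → x * y ≤ x * z
  *-monoʳ-≤ {x} {y} {z} 0≤x y≤z = begin
    x * y                   ≤⟨ x≤y+x (*-nonneg 0≤x (0≤y-x y≤z)) ⟩
    x * (z - y) + x * y     ≈⟨ distribˡ x (z - y) y ⟨
    x * ((z - y) + y)       ≈⟨ *-congˡ (+-assoc z (- y) y) ⟩
    x * (z + (- y + y))     ≈⟨ *-congˡ (+-congˡ (-‿inverseˡ y)) ⟩
    x * (z + 0#)            ≈⟨ *-congˡ (+-identityʳ z) ⟩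
    x * z                   ∎

  -- If 1 were at most 0, then - 1 would be nonnegative, and hence so would its square, which is 1.
  0≤1 : 0# ≤ 1#
  0≤1 with ≤-total 0# 1#
  ... | inj₁ 0≤1 = 0≤1
  ... | inj₂ 1≤0 = begin
    0#             ≤⟨ *-nonneg 0≤-1 0≤-1 ⟩
    - 1# * - 1#    ≈⟨ -‿distribˡ-* 1# (- 1#) ⟨
    - (1# * - 1#)  ≈⟨ -‿cong (*-identityˡ (- 1#)) ⟩
    - - 1#         ≈⟨ -‿involutive 1# ⟩
    1#             ∎
    where
    0≤-1 : 0# ≤ - 1#
    0≤-1 = ≤-trans (0≤y-x 1≤0) (≤-reflexive (+-identityˡ (- 1#)))

  0≤2 : 0# ≤ 1# + 1#
  0≤2 = +-nonneg 0≤1 0≤1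

  2*½≈1 : (1# + 1#) * ½ ≈ 1#
  2*½≈1 = ⁻¹-inverseʳ λ 2≈0 → 0≉1 (≤-antisym 0≤1 (≤-trans (x≤x+y 0≤1) (≤-reflexive 2≈0)))

  0≤½ : 0# ≤ ½
  0≤½ with ≤-total 0# ½
  ... | inj₁ 0≤½ = 0≤½
  ... | inj₂ ½≤0 = contradiction (≤-antisym 0≤1 1≤0) 0≉1
    where
    1≤0 : 1# ≤ 0#
    1≤0 = begin
      1#             ≈⟨ 2*½≈1 ⟨
      (1# + 1#) * ½  ≤⟨ *-monoʳ-≤ 0≤2 ½≤0 ⟩
      (1# + 1#) * 0# ≈⟨ zeroʳ _ ⟩
      0#             ∎

  half-+≤max : ∀ {x y z} → x ≤ y + z → ½ * x ≤ max y z
  half-+≤max {x} {y} {z} x≤y+z = begin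
    ½ * x                             ≤⟨ *-monoʳ-≤ 0≤½ x≤y+z ⟩
    ½ * (y + z)                       ≤⟨ *-monoʳ-≤ 0≤½ (+-mono-≤ (x≤max y z) (y≤max y z)) ⟩
    ½ * (max y z + max y z)           ≈⟨ *-congˡ (+-cong (*-identityˡ _) (*-identityˡ _)) ⟨
    ½ * (1# * max y z + 1# * max y z) ≈⟨ *-congˡ (distribʳ _ 1# 1#) ⟨
    ½ * ((1# + 1#) * max y z)         ≈⟨ *-assoc _ _ _ ⟨
    ½ * (1# + 1#) * max y z           ≈⟨ *-congʳ (trans (*-comm _ _) 2*½≈1) ⟩
    1# * max y z                      ≈⟨ *-identityˡ _ ⟩
    max y z                           ∎

  sum-nonneg : ∀ {n} {u : Vector Carrier n} → (∀ i → 0# ≤ u i) → 0# ≤ sum u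
  sum-nonneg {zero}  0≤u = ≤-refl
  sum-nonneg {suc n} 0≤u = +-nonneg (0≤u zero) (sum-nonneg (0≤u ∘ suc))

  ·-nonneg : ∀ n {x} → 0# ≤ x → 0# ≤ n · x
  ·-nonneg zero    0≤x = ≤-refl
  ·-nonneg (suc n) 0≤x = +-nonneg 0≤x (·-nonneg n 0≤x)

  ·-monoʳ-≤ : ∀ n {x y} → x ≤ y → n · x ≤ n · y
  ·-monoʳ-≤ zero    x≤y = ≤-refl
  ·-monoʳ-≤ (suc n) x≤y = +-mono-≤ x≤y (·-monoʳ-≤ n x≤y)

  step-mono : (h : ℕ → Carrier) → (∀ n → h n ≤ h (suc n)) → ∀ {k n} → k ℕ.≤ n → h k ≤ h n
  step-mono h step {k} {n} k≤n = go (ℕ.≤⇒≤′ k≤n)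
    where
    go : ∀ {n} → k ℕ.≤′ n → h k ≤ h n
    go (ℕ.≤′-reflexive ≡.refl) = ≤-refl
    go (ℕ.≤′-step k≤′n)        = ≤-trans (go k≤′n) (step _)

  -- The exchange argument

  -- Moving units from a product to an earlier one, as many as fit, is profitable.
  Exchange : (G₁ G₂ : ℕ → Carrier) (B₁ B₂ : ℕ) → Set ℓ₂
  Exchange G₁ G₂ B₁ B₂ = ∀ {a x} → a ℕ.≤ B₁ → x ℕ.≤ B₂ →
    G₁ a + G₂ x ≤ G₁ ((a ℕ.+ x) ℕ.⊓ B₁) + G₂ ((a ℕ.+ x) ℕ.∸ B₁)

  -- The witness d is the number of units moved: all x of them if they fit, otherwise the free room
  -- B ∸ a.
  exchange-split : ∀ {a B} x → a ℕ.≤ B →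
    ∃[ d ] (a ℕ.+ x) ℕ.⊓ B ≡ d ℕ.+ a × x ≡ d ℕ.+ ((a ℕ.+ x) ℕ.∸ B)
  exchange-split {a} {B} x a≤B with ℕ.≤-total (a ℕ.+ x) B
  ... | inj₁ u≤B rewrite ℕ.m≤n⇒m⊓n≡m u≤B | ℕ.m≤n⇒m∸n≡0 u≤B =
    x , ℕ.+-comm a x , ≡.sym (ℕ.+-identityʳ x)
  ... | inj₂ B≤u = B ℕ.∸ a ,
    ≡.trans (ℕ.m≥n⇒m⊓n≡n B≤u) (≡.sym (ℕ.m∸n+n≡m a≤B)) ,
    ℕ.+-cancelˡ-≡ a x _ split
    where
    split : a ℕ.+ x ≡ a ℕ.+ ((B ℕ.∸ a) ℕ.+ ((a ℕ.+ x) ℕ.∸ B))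
    split = ≡.sym (≡.trans (≡.sym (ℕ.+-assoc a (B ℕ.∸ a) _))
      (≡.trans (≡.cong (ℕ._+ ((a ℕ.+ x) ℕ.∸ B)) (ℕ.m+[n∸m]≡n a≤B)) (ℕ.m+[n∸m]≡n B≤u)))

  -- The products are emptied into the front one in turn, one exchange for each; once the front is
  -- full the others keep their units. The total of y is recorded because it is what the remaining
  -- products must accommodate in the next round.
  pour : ∀ {n} {G₀ : ℕ → Carrier} {B} (G : Fin n → ℕ → Carrier) (b : Vector ℕ n) →
         (∀ i → Exchange G₀ (G i) B (b i)) →
         ∀ {a} x → a ℕ.≤ B → (∀ i → x i ℕ.≤ b i) →
         ∃[ y ] (∀ i → y i ℕ.≤ b i) × total y ≡ (a ℕ.+ total x) ℕ.∸ B
              × G₀ a + sum (λ i → G i (x i)) ≤ G₀ ((a ℕ.+ total x) ℕ.⊓ B) + sum (λ i → G i (y i))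
  pour {zero} {G₀} {B} G b exch {a} x a≤B x≤b rewrite ℕ.+-identityʳ a =
    x , (λ ()) , ≡.sym (ℕ.m≤n⇒m∸n≡0 a≤B) ,
    ≤-reflexive (reflexive (≡.cong (λ e → G₀ e + 0#) (≡.sym (ℕ.m≤n⇒m⊓n≡m a≤B))))
  pour {suc n} {G₀} {B} G b exch {a} x a≤B x≤b
    with pour {n} {G₀} {B} (tail G) (tail b) (exch ∘ suc) {(a ℕ.+ x zero) ℕ.⊓ B} (tail x)
           (ℕ.m⊓n≤n (a ℕ.+ x zero) B) (x≤b ∘ suc)
  ... | y , y≤b , y-total , y-better = u ℕ.∸ B F.∷ y , ∷≤b , total-∷ , better
    where
    u = a ℕ.+ x zero
    s = total (tail x)

    ∷≤b : ∀ i → ((u ℕ.∸ B) F.∷ y) i ℕ.≤ b i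
    ∷≤b zero    = ℕ.≤-trans (ℕ.∸-monoˡ-≤ B (ℕ.+-monoˡ-≤ (x zero) a≤B))
                    (ℕ.≤-trans (ℕ.≤-reflexive (ℕ.m+n∸m≡n B (x zero))) (x≤b zero))
    ∷≤b (suc i) = y≤b i

    total-∷ : (u ℕ.∸ B) ℕ.+ total y ≡ (a ℕ.+ (x zero ℕ.+ s)) ℕ.∸ B
    total-∷ = ≡.trans (≡.cong ((u ℕ.∸ B) ℕ.+_) y-total)
      (≡.trans (∸-overflow u s B) (≡.cong (ℕ._∸ B) (ℕ.+-assoc a (x zero) s)))

    Σx = sum (λ i → G (suc i) (x (suc i)))
    Σy = sum (λ i → G (suc i) (y i))

    better : G₀ a + (G zero (x zero) + Σx) ≤
             G₀ ((a ℕ.+ (x zero ℕ.+ s)) ℕ.⊓ B) + (G zero (u ℕ.∸ B) + Σy)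
    better = begin
      G₀ a + (G zero (x zero) + Σx)                     ≈⟨ +-assoc _ _ _ ⟨
      G₀ a + G zero (x zero) + Σx                       ≤⟨ +-mono-≤ (exch zero a≤B (x≤b zero)) ≤-refl ⟩
      G₀ (u ℕ.⊓ B) + G zero (u ℕ.∸ B) + Σx              ≈⟨ xy∙z≈xz∙y _ _ _ ⟩
      G₀ (u ℕ.⊓ B) + Σx + G zero (u ℕ.∸ B)              ≤⟨ +-mono-≤ y-better ≤-refl ⟩
      G₀ ((u ℕ.⊓ B ℕ.+ s) ℕ.⊓ B) + Σy + G zero (u ℕ.∸ B) ≈⟨ +-assoc _ _ _ ⟩
      G₀ ((u ℕ.⊓ B ℕ.+ s) ℕ.⊓ B) + (Σy + G zero (u ℕ.∸ B)) ≈⟨ +-cong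
           (reflexive (≡.cong G₀ (≡.trans (⊓-overflow u s B) (≡.cong (ℕ._⊓ B) (ℕ.+-assoc a (x zero) s)))))
           (+-comm _ _) ⟩
      G₀ ((a ℕ.+ (x zero ℕ.+ s)) ℕ.⊓ B) + (G zero (u ℕ.∸ B) + Σy) ∎

  -- Pouring everything into the head leaves it with at most its share of ℓ, and monotonicity fills
  -- it up to that share. What overflows fits into the remaining supply, so the tail follows by
  -- induction.
  fillUp-optimal : ∀ {m} (G : Fin m → ℕ → Carrier) (b : Vector ℕ m) →
    (∀ i {k n} → k ℕ.≤ n → G i k ≤ G i n) →
    (∀ {j i} → j Fin.≤ i → Exchange (G j) (G i) (b j) (b i)) →
    ∀ {ℓ} x → (∀ i → x i ℕ.≤ b i) → total x ℕ.≤ ℓ →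
    sum (λ i → G i (x i)) ≤ sum (λ i → G i (fillUp b ℓ i))
  fillUp-optimal {zero}  G b mono exch x x≤b Σx≤ℓ = ≤-refl
  fillUp-optimal {suc m} G b mono exch x x≤b Σx≤ℓ
    with pour {G₀ = G zero} (tail G) (tail b) (λ i → exch z≤n) (tail x) (x≤b zero) (x≤b ∘ suc)
  ... | y , y≤b , y-total , y-better = ≤-trans y-better (+-mono-≤
    (mono zero (ℕ.⊓-monoˡ-≤ (head b) Σx≤ℓ))
    (fillUp-optimal (tail G) (tail b) (mono ∘ suc) (exch ∘ s≤s) y y≤b
      (≡.subst (ℕ._≤ _) (≡.sym y-total) (ℕ.∸-monoˡ-≤ (head b) Σx≤ℓ))))

  -- Each of the d units moved earns r₁ in place of r₂.
  linear-exchange : ∀ {r₁ r₂ B₁ B₂} → r₂ ≤ r₁ → Exchange (_· r₁) (_· r₂) B₁ B₂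
  linear-exchange {r₁} {r₂} {B₁} r₂≤r₁ {a} {x} a≤B _ with exchange-split x a≤B
  ... | d , a′≡ , x≡ = begin
    (a · r₁) + (x · r₂)                      ≈⟨ +-congˡ (×-congˡ x≡) ⟩
    (a · r₁) + ((d ℕ.+ x′) · r₂)             ≈⟨ +-congˡ (×-homo-+ r₂ d x′) ⟩
    (a · r₁) + ((d · r₂) + (x′ · r₂))        ≤⟨ +-monoʳ-≤ _ (+-mono-≤ (·-monoʳ-≤ d r₂≤r₁) ≤-refl) ⟩
    (a · r₁) + ((d · r₁) + (x′ · r₂))        ≈⟨ x∙yz≈y∙xz _ _ _ ⟩
    (d · r₁) + ((a · r₁) + (x′ · r₂))        ≈⟨ +-assoc _ _ _ ⟨
    (d · r₁) + (a · r₁) + (x′ · r₂)          ≈⟨ +-congʳ (×-homo-+ r₁ d a) ⟨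
    ((d ℕ.+ a) · r₁) + (x′ · r₂)             ≈⟨ +-congʳ (×-congˡ a′≡) ⟨
    (((a ℕ.+ x) ℕ.⊓ B₁) · r₁) + (x′ · r₂)    ∎
    where x′ = (a ℕ.+ x) ℕ.∸ B₁

  bonuses : (ℕ → Carrier) → ℕ → Carrier
  bonuses f n = sum {n} (λ k → f (suc (toℕ k)))

  -- `sum` peels off its first term, whereas the bonus of a new sale is the last.
  bonuses-suc : ∀ f n → bonuses f (suc n) ≈ bonuses f n + f (suc n)
  bonuses-suc f n = trans (sum-init-last {n} (λ k → f (suc (toℕ k)))) (+-cong
    (sum-cong-≋ {n} (λ k → reflexive (≡.cong (f ∘ suc) (Fin.toℕ-inject₁ k))))
    (reflexive (≡.cong (f ∘ suc) (Fin.toℕ-fromℕ n))))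

  module _ {f : ℕ → Carrier} (f-bonus : IsBonus f) where
    open IsBonus f-bonus

    bonuses-mono : ∀ {k n} → k ℕ.≤ n → bonuses f k ≤ bonuses f n
    bonuses-mono = step-mono (bonuses f) λ n →
      ≤-trans (x≤x+y (nonneg (suc n))) (≤-reflexive (sym (bonuses-suc f n)))

    -- The marginal bonuses increase: each of d units stacked on a earns at least what it earns on
    -- the lower stack x.
    bonuses-convex : ∀ d {a x} → x ℕ.≤ a →
      bonuses f a + bonuses f (d ℕ.+ x) ≤ bonuses f (d ℕ.+ a) + bonuses f x
    bonuses-convex zero    x≤a = ≤-refl
    bonuses-convex (suc d) {a} {x} x≤a = begin
      bonuses f a + bonuses f (suc d ℕ.+ x)                    ≈⟨ +-congˡ (bonuses-suc f (d ℕ.+ x)) ⟩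
      bonuses f a + (bonuses f (d ℕ.+ x) + f (suc (d ℕ.+ x)))  ≈⟨ +-assoc _ _ _ ⟨
      bonuses f a + bonuses f (d ℕ.+ x) + f (suc (d ℕ.+ x))    ≤⟨ +-mono-≤ (bonuses-convex d x≤a)
                                                                 (monotone (s≤s (ℕ.+-monoʳ-≤ d x≤a))) ⟩
      bonuses f (d ℕ.+ a) + bonuses f x + f (suc (d ℕ.+ a))    ≈⟨ xy∙z≈xz∙y _ _ _ ⟩
      bonuses f (d ℕ.+ a) + f (suc (d ℕ.+ a)) + bonuses f x    ≈⟨ +-congʳ (bonuses-suc f (d ℕ.+ a)) ⟨
      bonuses f (suc d ℕ.+ a) + bonuses f x                    ∎

    bonus-exchange : ∀ {B₁ B₂} → B₂ ℕ.≤ B₁ → Exchange (bonuses f) (bonuses f) B₁ B₂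
    bonus-exchange {B₁} B₂≤B₁ {a} {x} a≤B₁ x≤B₂ with exchange-split x a≤B₁
    ... | d , a′≡ , x≡ = begin
      bonuses f a + bonuses f x                           ≈⟨ +-congˡ (reflexive (≡.cong (bonuses f) x≡)) ⟩
      bonuses f a + bonuses f (d ℕ.+ x′)                  ≤⟨ bonuses-convex d x′≤a ⟩
      bonuses f (d ℕ.+ a) + bonuses f x′                  ≈⟨ +-congʳ (reflexive (≡.cong (bonuses f) a′≡)) ⟨
      bonuses f ((a ℕ.+ x) ℕ.⊓ B₁) + bonuses f x′         ∎
      where
      x′ = (a ℕ.+ x) ℕ.∸ B₁
      -- Convexity pays only if the moved units are restacked no lower than before. The capacity
      -- order ensures it: x is at most B₂, hence at most B₁, so no more than a units stay behind.
      x′≤a : x′ ℕ.≤ a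
      x′≤a = ℕ.≤-trans (ℕ.∸-monoˡ-≤ B₁ (ℕ.+-monoʳ-≤ a (ℕ.≤-trans x≤B₂ B₂≤B₁)))
               (ℕ.≤-reflexive (ℕ.m+n∸n≡m a B₁))

  -- The offline optimum against the two fills

  foldr-max≤ : ∀ {z} {a} {A : Set a} (h : A → Carrier) xs → 0# ≤ z → (∀ {x} → x ∈ xs → h x ≤ z) →
               List.foldr max 0# (List.map h xs) ≤ z
  foldr-max≤ h []       0≤z h≤z = 0≤z
  foldr-max≤ h (x ∷ xs) 0≤z h≤z =
    max-lub (h≤z (here ≡.refl)) (foldr-max≤ h xs 0≤z (h≤z ∘ there))

  box-bounded : ∀ {n} (u : Vector ℕ n) {x} → x ∈ box u → ∀ i → x i ℕ.≤ u i
  box-bounded {suc n} u x∈ i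
    with ∈-cartesianProductWith⁻ F._∷_ (List.upTo (suc (head u))) (box (tail u)) x∈ | i
  ... | a , y , a∈ , y∈ , ≡.refl | zero  = ℕ.≤-pred (∈-upTo⁻ a∈)
  ... | a , y , a∈ , y∈ , ≡.refl | suc i = box-bounded (tail u) y∈ i

  module _ (I : Instance) where
    open Instance I

    R-nonneg : ∀ i n → 0# ≤ R I i n
    R-nonneg i n = +-nonneg (·-nonneg n (r-nonneg i)) (sum-nonneg {n} (λ k → IsBonus.nonneg (f-bonus i) _))

    -- Reindexing by σ turns products into positions, where the order is that of `Fin` and
    -- `fillUp-optimal` applies.
    greedy : (G : Fin m → ℕ → Carrier) (σ : Ordering I) →
      (∀ i {k n} → k ℕ.≤ n → G i k ≤ G i n) →
      (∀ {j i} → j Fin.≤ i → Exchange (G (σ ⟨$⟩ʳ j)) (G (σ ⟨$⟩ʳ i)) (b (σ ⟨$⟩ʳ j)) (b (σ ⟨$⟩ʳ i))) →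
      ∀ {ℓ} {x : Vector ℕ m} → (∀ i → x i ℕ.≤ b i) → total x ℕ.≤ ℓ → ∀ {y : Vector ℕ m} →
      y ∘ (σ ⟨$⟩ʳ_) ≗ fillUp (b ∘ (σ ⟨$⟩ʳ_)) ℓ →
      sum (λ i → G i (x i)) ≤ sum (λ i → G i (y i))
    greedy G σ mono exch {ℓ} {x} x≤b Σx≤ℓ {y} y-fill = begin
      sum (λ i → G i (x i))                      ≈⟨ sum-permute _ σ ⟩
      sum (λ j → G (σ ⟨$⟩ʳ j) (x (σ ⟨$⟩ʳ j)))    ≤⟨ fillUp-optimal (G ∘ (σ ⟨$⟩ʳ_)) _ (mono ∘ (σ ⟨$⟩ʳ_)) exch _
                                                      (x≤b ∘ (σ ⟨$⟩ʳ_)) (≡.subst (ℕ._≤ ℓ) (total-permute x σ) Σx≤ℓ) ⟩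
      sum (λ j → G (σ ⟨$⟩ʳ j) (fillUp _ ℓ j))    ≈⟨ sum-cong-≋ (λ j → reflexive (≡.cong (G (σ ⟨$⟩ʳ j)) (y-fill j))) ⟨
      sum (λ j → G (σ ⟨$⟩ʳ j) (y (σ ⟨$⟩ʳ j)))    ≈⟨ sum-permute _ σ ⟨
      sum (λ i → G i (y i))                      ∎

    module _ {g : ℕ → Carrier} (hom : Homogeneous I g) where

      R≈ : ∀ i n → R I i n ≈ (n · r i) + bonuses g n
      R≈ i n = +-congˡ (sum-cong-≋ {n} (λ k → hom i _))

      U≤base+cap : IsBonus g → (base cap : Ordering I) → NonincreasingBase I base → NonincreasingCapacity I cap →
        ∀ {ℓ} (y z : Vector ℕ m) →
        y ∘ (base ⟨$⟩ʳ_) ≗ fillUp (b ∘ (base ⟨$⟩ʳ_)) ℓ →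
        z ∘ (cap ⟨$⟩ʳ_) ≗ fillUp (b ∘ (cap ⟨$⟩ʳ_)) ℓ →
        U I ℓ ≤ totalReward I y + totalReward I z
      U≤base+cap g-bonus base cap base-ok cap-ok {ℓ} y z y-fill z-fill =
        foldr-max≤ (totalReward I) (allocations I ℓ)
          (+-nonneg (sum-nonneg (λ i → R-nonneg i (y i))) (sum-nonneg (λ i → R-nonneg i (z i)))) bound
        where
        F = bonuses g
        linear bonus : Vector ℕ m → Carrier
        linear x = sum (λ i → x i · r i)
        bonus  x = sum (λ i → F (x i))
        split : ∀ x → totalReward I x ≈ linear x + bonus x
        split x = trans (sum-cong-≋ (λ i → R≈ i (x i))) (∑-distrib-+ {m} _ _)
        linear-nonneg : ∀ x → 0# ≤ linear x
        linear-nonneg x = sum-nonneg (λ i → ·-nonneg (x i) (r-nonneg i))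
        bonus-nonneg : ∀ x → 0# ≤ bonus x
        bonus-nonneg x = sum-nonneg (λ i → sum-nonneg {x i} (λ k → IsBonus.nonneg g-bonus _))
        bound : ∀ {x} → x ∈ allocations I ℓ → totalReward I x ≤ totalReward I y + totalReward I z
        bound {x} x∈ with ∈-filter⁻ (λ x → F.foldr ℕ._+_ 0 x ℕ.≤? ℓ) {xs = box b} x∈
        ... | x∈box , Σx≤ℓ = begin
          totalReward I x                    ≈⟨ split x ⟩
          linear x + bonus x                 ≤⟨ +-mono-≤
            (greedy (λ i n → n · r i) base
              (λ i → step-mono (_· r i) (λ n → x≤y+x (r-nonneg i)))
              (λ j≤i → linear-exchange (base-ok j≤i))
              (box-bounded b x∈box) Σx≤ℓ {y} y-fill)
            (greedy (λ _ → F) cap (λ _ → bonuses-mono g-bonus)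
              (λ j≤i → bonus-exchange g-bonus (cap-ok j≤i))
              (box-bounded b x∈box) Σx≤ℓ {z} z-fill) ⟩
          -- One vector carries the linear part and the other the bonuses. Adding the nonnegative
          -- bonuses of y and base rewards of z completes two full rewards, and this is where the
          -- factor one half originates.
          linear y + bonus z                 ≤⟨ +-mono-≤ (x≤x+y (bonus-nonneg y)) (x≤y+x (linear-nonneg z)) ⟩
          (linear y + bonus y) + (linear z + bonus z) ≈⟨ +-cong (split y) (split z) ⟨
          totalReward I y + totalReward I z  ∎

  -- Expectations over arrival sequences

  listSum : ∀ {a} {A : Set a} → (A → Carrier) → List A → Carrier
  listSum h xs = List.foldr _+_ 0# (List.map h xs)

  module _ {a} {A : Set a} where

    listSum-cong : ∀ {h k : A → Carrier} → (∀ x → h x ≈ k x) → ∀ xs → listSum h xs ≈ listSum k xs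
    listSum-cong h≈k []       = refl
    listSum-cong h≈k (x ∷ xs) = +-cong (h≈k x) (listSum-cong h≈k xs)

    listSum-mono : ∀ {h k : A → Carrier} → (∀ x → h x ≤ k x) → ∀ xs → listSum h xs ≤ listSum k xs
    listSum-mono h≤k []       = ≤-refl
    listSum-mono h≤k (x ∷ xs) = +-mono-≤ (h≤k x) (listSum-mono h≤k xs)

    listSum-+ : ∀ (h k : A → Carrier) xs → listSum (λ x → h x + k x) xs ≈ listSum h xs + listSum k xs
    listSum-+ h k []       = sym (+-identityˡ 0#)
    listSum-+ h k (x ∷ xs) = trans (+-congˡ (listSum-+ h k xs)) (interchange _ _ _ _)

    listSum-*ˡ : ∀ z (h : A → Carrier) xs → listSum (λ x → z * h x) xs ≈ z * listSum h xs
    listSum-*ˡ z h []       = sym (zeroʳ z)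
    listSum-*ˡ z h (x ∷ xs) = trans (+-congˡ (listSum-*ˡ z h xs)) (sym (distribˡ z _ _))

    listSum-map-++ : ∀ {b} {B : Set b} (h : A → Carrier) (k : B → A) xs ys →
      listSum h (List.map k xs ++ ys) ≈ listSum (h ∘ k) xs + listSum h ys
    listSum-map-++ h k []       ys = sym (+-identityˡ _)
    listSum-map-++ h k (x ∷ xs) ys = trans (+-congˡ (listSum-map-++ h k xs ys)) (sym (+-assoc _ _ _))

  expectation : ∀ {n} → Vector Carrier n → (Vec Bool n → Carrier) → Carrier
  expectation {n} q W = listSum (λ ω → prob q ω * W ω) (outcomes n)

  prob-nonneg : ∀ {n} (q : Vector Carrier n) → (∀ t → 0# ≤ q t) → (∀ t → q t ≤ 1#) →
                ∀ ω → 0# ≤ prob q ω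
  prob-nonneg q 0≤q q≤1 []          = 0≤1
  prob-nonneg q 0≤q q≤1 (true  ∷ ω) =
    *-nonneg (0≤q zero) (prob-nonneg (tail q) (0≤q ∘ suc) (q≤1 ∘ suc) ω)
  prob-nonneg q 0≤q q≤1 (false ∷ ω) =
    *-nonneg (0≤y-x (q≤1 zero)) (prob-nonneg (tail q) (0≤q ∘ suc) (q≤1 ∘ suc) ω)

  expectation-suc : ∀ {n} (q : Vector Carrier (suc n)) W → expectation q W ≈
    head q * expectation (tail q) (W ∘ (true ∷_)) + (1# - head q) * expectation (tail q) (W ∘ (false ∷_))
  expectation-suc {n} q W = trans
    (listSum-map-++ _ (true ∷_) (outcomes n) _) (+-cong (factor true) (trans
    (listSum-map-++ _ (false ∷_) (outcomes n) []) (trans (+-identityʳ _) (factor false))))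
    where
    factor : ∀ a → listSum (λ ω → prob q (a ∷ ω) * W (a ∷ ω)) (outcomes n) ≈
                   (if a then head q else 1# - head q) * expectation (tail q) (W ∘ (a ∷_))
    factor a = trans (listSum-cong (λ ω → *-assoc _ _ _) (outcomes n)) (listSum-*ˡ _ _ (outcomes n))

  -- The expected payoff S j′ after the periods t, …, t + d ∸ 1, where j′ is j
  -- plus the number of arrivals in them.
  valueFrom : (S q : ℕ → Carrier) (d t j : ℕ) → Carrier
  valueFrom S q zero    t j = S j
  valueFrom S q (suc d) t j =
    q t * valueFrom S q d (suc t) (suc j) + (1# - q t) * valueFrom S q d (suc t) j

  -- Conditioning on the first period: an arrival advances both t and j, its absence only t. The
  -- probabilities are read from q at absolute times, so that passing to the tail of p is a shift of
  -- t.
  expectation≈valueFrom : ∀ S q {n} (p : Vector Carrier n) t j → (∀ i → p i ≡ q (t ℕ.+ toℕ i)) →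
    expectation p (λ ω → S (j ℕ.+ Vec.count T? ω)) ≈ valueFrom S q n t j
  expectation≈valueFrom S q {zero}  p t j p≡q = trans (+-identityʳ _)
    (trans (*-identityˡ _) (reflexive (≡.cong S (ℕ.+-identityʳ j))))
  expectation≈valueFrom S q {suc n} p t j p≡q = trans (expectation-suc p _) (+-cong
    (*-cong p₀≈ (trans
      (listSum-cong (λ ω → *-congˡ (reflexive (≡.cong S (ℕ.+-suc j (Vec.count T? ω))))) (outcomes n))
      (expectation≈valueFrom S q (tail p) (suc t) (suc j) tail≡)))
    (*-cong (+-congˡ (-‿cong p₀≈)) (expectation≈valueFrom S q (tail p) (suc t) j tail≡)))
    where
    p₀≈ : head p ≈ q t
    p₀≈ = reflexive (≡.trans (p≡q zero) (≡.cong q (ℕ.+-identityʳ t)))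
    tail≡ : ∀ i → tail p i ≡ q (suc t ℕ.+ toℕ i)
    tail≡ i = ≡.trans (p≡q (suc i)) (≡.cong q (ℕ.+-suc t (toℕ i)))

  convex-combination : ∀ z x → z * x + (1# - z) * x ≈ x
  convex-combination z x = begin-equality
    z * x + (1# - z) * x ≈⟨ distribʳ x z (1# - z) ⟨
    (z + (1# - z)) * x   ≈⟨ *-congʳ (+-comm _ _) ⟩
    (1# - z + z) * x     ≈⟨ *-congʳ (+-assoc _ _ _) ⟩
    (1# + (- z + z)) * x ≈⟨ *-congʳ (+-congˡ (-‿inverseˡ z)) ⟩
    (1# + 0#) * x        ≈⟨ *-congʳ (+-identityʳ 1#) ⟩
    1# * x               ≈⟨ *-identityˡ x ⟩
    x                    ∎

  -- Every step averages two values that both equal S N, with weights summing to 1.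
  valueFrom-const : ∀ S q {N} → (∀ {j} → N ℕ.≤ j → S j ≈ S N) →
    ∀ d t {j} → N ℕ.≤ j → valueFrom S q d t j ≈ S N
  valueFrom-const S q const zero    t N≤j = const N≤j
  valueFrom-const S q const (suc d) t N≤j = trans
    (+-cong (*-congˡ (valueFrom-const S q const d (suc t) (ℕ.m≤n⇒m≤1+n N≤j)))
            (*-congˡ (valueFrom-const S q const d (suc t) N≤j)))
    (convex-combination (q t) _)

  -- Fill algorithms as functions of the number of arrivals

  module _ (I : Instance) where
    open Instance I

    𝔼-cong : ∀ {X Y : Arrivals I → Carrier} → (∀ ω → X ω ≈ Y ω) → 𝔼 I X ≈ 𝔼 I Y
    𝔼-cong X≈Y = listSum-cong (λ ω → *-congˡ (X≈Y ω)) (outcomes T)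

    𝔼-mono : ∀ {X Y : Arrivals I → Carrier} → (∀ ω → X ω ≤ Y ω) → 𝔼 I X ≤ 𝔼 I Y
    𝔼-mono X≤Y = listSum-mono (λ ω → *-monoʳ-≤ (prob-nonneg p p-nonneg p≤1 ω) (X≤Y ω)) (outcomes T)

    𝔼-+ : ∀ (X Y : Arrivals I → Carrier) → 𝔼 I (λ ω → X ω + Y ω) ≈ 𝔼 I X + 𝔼 I Y
    𝔼-+ X Y = trans (listSum-cong (λ ω → distribˡ _ _ _) (outcomes T)) (listSum-+ _ _ (outcomes T))

    module _ (σ : Ordering I) where

      -- The argument counts arrivals, not sales: the sequence becomes constant once every product
      -- is full.
      soldAfter : ℕ → Vector ℕ m
      soldAfter zero    = λ _ → 0
      soldAfter (suc j) = serve I (fill I σ) (soldAfter j) true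

      reward : ℕ → Carrier
      reward j = totalReward I (soldAfter j)

      foldl≡soldAfter : ∀ {n} j (ω : Vec Bool n) →
        Vec.foldl (λ _ → Vector ℕ m) (serve I (fill I σ)) (soldAfter j) ω ≡ soldAfter (j ℕ.+ Vec.count T? ω)
      foldl≡soldAfter j []          = ≡.cong soldAfter (≡.sym (ℕ.+-identityʳ j))
      foldl≡soldAfter j (true ∷ ω)  = ≡.trans (foldl≡soldAfter (suc j) ω)
                                        (≡.cong soldAfter (≡.sym (ℕ.+-suc j _)))
      foldl≡soldAfter j (false ∷ ω) = foldl≡soldAfter j ω

      sales≡ : ∀ ω → sales I (fill I σ) ω ≡ soldAfter (L I ω)
      sales≡ = foldl≡soldAfter 0

      𝔼Rev≈ : 𝔼 I (Rev I (fill I σ)) ≈ valueFrom reward (extend 0# p) T 0 0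
      𝔼Rev≈ = trans (𝔼-cong (λ ω → reflexive (≡.cong (totalReward I) (sales≡ ω))))
                     (expectation≈valueFrom reward (extend 0# p) p 0 0 (λ i → ≡.sym (extend-toℕ 0# p i)))

      fill-view : ∀ x →
        ((∀ j → ¬ x (σ ⟨$⟩ʳ j) ℕ.< b (σ ⟨$⟩ʳ j)) × fill I σ x ≡ nothing)
        ⊎ (∃[ j ] x (σ ⟨$⟩ʳ j) ℕ.< b (σ ⟨$⟩ʳ j)
                 × (∀ {i} → i Fin.< j → ¬ x (σ ⟨$⟩ʳ i) ℕ.< b (σ ⟨$⟩ʳ i))
                 × fill I σ x ≡ just (σ ⟨$⟩ʳ j))
      fill-view x = find-tabulate (λ i → x i ℕ.<? b i) (σ ⟨$⟩ʳ_)

      -- Both sides advance at the same place: at the first open position by `fillUp-first`, or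
      -- nowhere by `fillUp-full`.
      soldAfter-fillUp : ∀ ℓ → soldAfter ℓ ∘ (σ ⟨$⟩ʳ_) ≗ fillUp (b ∘ (σ ⟨$⟩ʳ_)) ℓ
      soldAfter-fillUp zero    j = ≡.sym (fillUp-0 _ j)
      soldAfter-fillUp (suc ℓ) i with fill-view (soldAfter ℓ)
      ... | inj₁ (full , eq) rewrite eq = ≡.trans (soldAfter-fillUp ℓ i) (≡.sym
              (fillUp-full _ ℓ (λ j → full j ∘ ≡.subst (ℕ._< _) (≡.sym (soldAfter-fillUp ℓ j))) i))
      ... | inj₂ (j , open-j , first , eq) rewrite eq = ≡.trans
              (updateAt-∘ (soldAfter ℓ) (σ ⟨$⟩ʳ_) (perm-injective σ) j i) (≡.trans
              (updateAt-cong-≗ (soldAfter-fillUp ℓ) j i) (≡.sym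
              (fillUp-first _ ℓ (≡.subst (ℕ._< _) (soldAfter-fillUp ℓ j) open-j)
                (λ {i} i<j → first i<j ∘ ≡.subst (ℕ._< _) (≡.sym (soldAfter-fillUp ℓ i))) i)))

      soldAfter≤b : ∀ ℓ i → soldAfter ℓ i ℕ.≤ b i
      soldAfter≤b ℓ i = ≡.subst (λ i → soldAfter ℓ i ℕ.≤ b i) (inverseʳ σ)
        (ℕ.≤-trans (ℕ.≤-reflexive (soldAfter-fillUp ℓ (σ ⟨$⟩ˡ i))) (fillUp≤ _ ℓ (σ ⟨$⟩ˡ i)))

      sales-fillUp : ∀ ω → sales I (fill I σ) ω ∘ (σ ⟨$⟩ʳ_) ≗ fillUp (b ∘ (σ ⟨$⟩ʳ_)) (L I ω)
      sales-fillUp ω rewrite sales≡ ω = soldAfter-fillUp (L I ω)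

      serve-just : ∀ {x j} → fill I σ x ≡ just j → serve I (fill I σ) x true ≡ updateAt x j suc
      serve-just {x} eq = ≡.cong (maybe′ (λ i → updateAt x i suc) x) eq

      soldAfter-stuck : ∀ {N} → fill I σ (soldAfter N) ≡ nothing → ∀ {j} → N ℕ.≤ j → soldAfter j ≡ soldAfter N
      soldAfter-stuck {N} eq N≤j = go (ℕ.≤⇒≤′ N≤j)
        where
        go : ∀ {j} → N ℕ.≤′ j → soldAfter j ≡ soldAfter N
        go (ℕ.≤′-reflexive ≡.refl) = ≡.refl
        go (ℕ.≤′-step N≤′j) rewrite go N≤′j = ≡.cong (maybe′ (λ i → updateAt (soldAfter N) i suc) (soldAfter N)) eq

    module _ {g : ℕ → Carrier} (g-bonus : IsBonus g) (hom : Homogeneous I g) where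

      half-approximation : (base cap : Ordering I) → NonincreasingBase I base → NonincreasingCapacity I cap →
        ½ * 𝔼 I (λ ω → U I (L I ω)) ≤ max (𝔼 I (Rev I (fill I base))) (𝔼 I (Rev I (fill I cap)))
      half-approximation base cap base-ok cap-ok = half-+≤max (≤-trans
        (𝔼-mono (λ ω → U≤base+cap I hom g-bonus base cap base-ok cap-ok
          (sales I (fill I base) ω) (sales I (fill I cap) ω) (sales-fillUp base ω) (sales-fillUp cap ω)))
        (≤-reflexive (𝔼-+ _ _)))

  -- A program logic with costs

  -- The propositions decided by `evalᵗ`, so that guards become hypotheses. Comparisons of numbers
  -- are lifted to the level of comparisons in the field.
  Holds : Store → Test → Set ℓ₂
  Holds s (d <ⁿ e)  = Lift ℓ₂ (evalⁿ s d ℕ.< evalⁿ s e)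
  Holds s (d ≤ᵏ e)  = evalᵏ s d ≤ evalᵏ s e
  Holds s (t and u) = Holds s t × Holds s u
  Holds s (neg t)   = ¬ Holds s t

  lift-reflects : ∀ {a b} {A : Set a} {x} → Reflects A x → Reflects (Lift b A) x
  lift-reflects (ofʸ a)  = ofʸ (lift a)
  lift-reflects (ofⁿ ¬a) = ofⁿ (¬a ∘ lower)

  evalᵗ-reflects : ∀ s t → Reflects (Holds s t) (evalᵗ s t)
  evalᵗ-reflects s (d <ⁿ e)  = lift-reflects (proof (evalⁿ s d ℕ.<? evalⁿ s e))
  evalᵗ-reflects s (d ≤ᵏ e)  = proof (evalᵏ s d ≤? evalᵏ s e)
  evalᵗ-reflects s (t and u) = evalᵗ-reflects s t ×-reflects evalᵗ-reflects s u
  evalᵗ-reflects s (neg t)   = ¬-reflects (evalᵗ-reflects s t)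

  -- A Hoare triple for total correctness, with the bound N on the number of steps.
  record Runs {p} (P : Program) (s : Store) (N : ℕ) (Post : Store → Set p) : Set (c ⊔ p) where
    constructor runs
    field
      {final} : Store
      {cost}  : ℕ
      run     : ⟨ P , s ⟩⇓⟨ final , cost ⟩
      cost≤   : cost ℕ.≤ N
      post    : Post final

  module _ {p} {Post : Store → Set p} where

    run-≤ : ∀ {P s M N} → M ℕ.≤ N → Runs P s M Post → Runs P s N Post
    run-≤ M≤N (runs r c≤ q) = runs r (ℕ.≤-trans c≤ M≤N) q

    run-map : ∀ {q} {Mid : Store → Set q} {P s N} → (∀ {s′} → Mid s′ → Post s′) →
              Runs P s N Mid → Runs P s N Post
    run-map f (runs r c≤ q) = runs r c≤ (f q)

    run-skip : ∀ {s} → Post s → Runs skip s 1 Post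
    run-skip q = runs skip ℕ.≤-refl q

    run-seq : ∀ {q} {Mid : Store → Set q} {P Q s M N} → Runs P s M Mid →
              (∀ {s′} → Mid s′ → Runs Q s′ N Post) → Runs (P ⨾ Q) s (M ℕ.+ N) Post
    run-seq (runs r c≤ q) f with f q
    ... | runs r′ c≤′ q′ = runs (seq r r′) (ℕ.+-mono-≤ c≤ c≤′) q′

    run-nat : ∀ {s a d e} → Post (store (write a (evalⁿ s d) (evalⁿ s e) (nats s)) (nums s)) →
              Runs (nat[ a , d ]:= e) s (suc (costⁿ d ℕ.+ costⁿ e)) Post
    run-nat q = runs assignⁿ ℕ.≤-refl q

    run-num : ∀ {s a d e} → Post (store (nats s) (write a (evalⁿ s d) (evalᵏ s e) (nums s))) →
              Runs (num[ a , d ]:= e) s (suc (costⁿ d ℕ.+ costᵏ e)) Post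
    run-num q = runs assignᵏ ℕ.≤-refl q

    run-when : ∀ {s P Q N} t → (Holds s t → Runs P s N Post) → (¬ Holds s t → Runs Q s N Post) →
               Runs (when t run P else Q) s (suc (costᵗ t ℕ.+ N)) Post
    run-when {s} t yes-case no-case with evalᵗ s t in eq | evalᵗ-reflects s t
    ... | true  | ofʸ h  with yes-case h
    ...   | runs r c≤ q = runs (when-true eq r) (s≤s (ℕ.+-monoʳ-≤ (costᵗ t) c≤)) q
    run-when {s} t yes-case no-case | false | ofⁿ ¬h with no-case ¬h
    ...   | runs r c≤ q = runs (when-false eq r) (s≤s (ℕ.+-monoʳ-≤ (costᵗ t) c≤)) q

  -- The index of the invariant bounds the number of remaining iterations.
  run-while : ∀ {p} (Inv : ℕ → Store → Set p) {P N} t →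
    (∀ {n s} → Inv n s → Holds s t → ∃[ n′ ] n ≡ suc n′ × Runs P s N (Inv n′)) →
    ∀ n {s} → Inv n s →
    Runs (while t run P) s (suc (costᵗ t) ℕ.+ n ℕ.* (suc (costᵗ t) ℕ.+ N))
         (λ s′ → ¬ Holds s′ t × ∃[ n′ ] Inv n′ s′)
  run-while Inv {P} {N} t body n {s} inv with evalᵗ s t in eq | evalᵗ-reflects s t
  ... | false | ofⁿ ¬h = runs (while-false eq) (ℕ.m≤m+n _ _) (¬h , n , inv)
  ... | true  | ofʸ h  with body inv h
  ...   | n′ , ≡.refl , runs r c≤ inv′ with run-while Inv t body n′ inv′
  ...     | runs r′ c≤′ q = runs (while-true eq r r′)
              (s≤s (ℕ.+-monoʳ-≤ (costᵗ t) bound)) q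
    where
    k = suc (costᵗ t)
    bound = ℕ.≤-trans (ℕ.+-mono-≤ c≤ c≤′) (ℕ.≤-reflexive
      (≡.trans (≡.sym (ℕ.+-assoc N k _)) (≡.cong (ℕ._+ n′ ℕ.* (k ℕ.+ N)) (ℕ.+-comm N k))))

  -- A frame condition given by two thresholds: h for the natural-number arrays and v for the field
  -- arrays.
  record Keeps (h v : ℕ) (s s′ : Store) : Set c where
    constructor keeps
    field
      nats-kept : ∀ {a} j → a ℕ.< h → nats s′ a j ≡ nats s a j
      nums-kept : ∀ {a} j → a ℕ.< v → nums s′ a j ≡ nums s a j
  open Keeps

  keeps-refl : ∀ {h v s} → Keeps h v s s
  keeps-refl = keeps (λ _ _ → ≡.refl) (λ _ _ → ≡.refl)

  keeps-trans : ∀ {h v s s′ s″} → Keeps h v s s′ → Keeps h v s′ s″ → Keeps h v s s″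
  keeps-trans k l = keeps (λ j a<h → ≡.trans (nats-kept l j a<h) (nats-kept k j a<h))
                          (λ j a<v → ≡.trans (nums-kept l j a<v) (nums-kept k j a<v))

  keeps-≤ : ∀ {h v h′ v′ s s′} → h′ ℕ.≤ h → v′ ℕ.≤ v → Keeps h v s s′ → Keeps h′ v′ s s′
  keeps-≤ h′≤h v′≤v k = keeps (λ j a<h′ → nats-kept k j (ℕ.≤-trans a<h′ h′≤h))
                              (λ j a<v′ → nums-kept k j (ℕ.≤-trans a<v′ v′≤v))

  keeps-nat : ∀ {h v s s′ a} i {x} → h ℕ.≤ a → Keeps h v s s′ →
              Keeps h v s (store (write a i x (nats s′)) (nums s′))
  keeps-nat {s′ = s′} {a} i {x} h≤a k = keeps
    (λ j a′<h → ≡.trans (write-array i x (nats s′) j (ℕ.<⇒≢ (ℕ.<-≤-trans a′<h h≤a) ∘ ≡.sym)) (nats-kept k j a′<h))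
    (nums-kept k)

  keeps-num : ∀ {h v s s′ a} i {x} → v ℕ.≤ a → Keeps h v s s′ →
              Keeps h v s (store (nats s′) (write a i x (nums s′)))
  keeps-num {s′ = s′} {a} i {x} v≤a k = keeps (nats-kept k)
    (λ j a′<v → ≡.trans (write-array i x (nums s′) j (ℕ.<⇒≢ (ℕ.<-≤-trans a′<v v≤a) ∘ ≡.sym)) (nums-kept k j a′<v))

  sum-updateAt : ∀ {n} (G : Fin n → ℕ → Carrier) x i {w} → G i (suc (x i)) ≈ G i (x i) + w →
                 sum (λ k → G k (updateAt x i suc k)) ≈ sum (λ k → G k (x k)) + w
  sum-updateAt G x zero    eq = trans (+-congʳ eq) (xy∙z≈xz∙y _ _ _)
  sum-updateAt G x (suc i) eq = trans (+-congˡ (sum-updateAt (G ∘ suc) (x ∘ suc) i eq)) (sym (+-assoc _ _ _))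


  -- Searching for the next product to sell

  module _ (I : Instance) {g : ℕ → Carrier} (hom : Homogeneous I g)
           (cap : Ordering I) (cap-ok : NonincreasingCapacity I cap) where
    open Instance I

    C : ℕ
    C = totalCapacity I

    positive-prefix-cap : ∀ {k} (k<m : k ℕ.< m) → 0 ℕ.< b (cap ⟨$⟩ʳ fromℕ< k<m) → k ℕ.< C
    positive-prefix-cap {k} k<m pos = ≡.subst₂ ℕ._<_ (Fin.toℕ-fromℕ< k<m) (≡.sym (total-permute b cap))
      (positive-prefix (b ∘ (cap ⟨$⟩ʳ_)) (fromℕ< k<m) (λ j≤k → ℕ.<-≤-trans pos (cap-ok j≤k)))

    R-suc : ∀ i n → R I i (suc n) ≈ R I i n + (r i + g (suc n))
    R-suc i n = begin-equality
      R I i (suc n)                                ≈⟨ R≈ I hom i (suc n) ⟩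
      (r i + (n · r i)) + F (suc n)                ≈⟨ +-cong (+-comm _ _) (bonuses-suc g n) ⟩
      ((n · r i) + r i) + (F n + g (suc n))        ≈⟨ interchange _ _ _ _ ⟩
      ((n · r i) + F n) + (r i + g (suc n))        ≈⟨ +-congʳ (R≈ I hom i n) ⟨
      R I i n + (r i + g (suc n))                  ∎
      where
      F = bonuses g

    totalReward-sale : ∀ x i → totalReward I (updateAt x i suc) ≈ totalReward I x + (r i + g (suc (x i)))
    totalReward-sale x i = sum-updateAt (R I) x i (R-suc i (x i))

    module _ (σ : Ordering I) where

      position : Fin m → ℕ
      position i = toℕ (σ ⟨$⟩ˡ i)

      module _ (x : Vector ℕ m) where

        Open : Fin m → Set
        Open i = x i ℕ.< b i

        Attained : ℕ → Set
        Attained q = q ≡ m ⊎ ∃[ j ] q ≡ toℕ j × Open (σ ⟨$⟩ʳ j)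

        -- The invariant of the scan. Products are visited in the order `cap` while positions in σ
        -- are minimised, so after k steps nothing is known about the products not yet visited.
        Scanned : (k q : ℕ) → Set
        Scanned k q = (∀ j → toℕ j ℕ.< k → Open (cap ⟨$⟩ʳ j) → q ℕ.≤ position (cap ⟨$⟩ʳ j)) × Attained q

        First : ℕ → Set
        First q = (∀ i → Open i → q ℕ.≤ position i) × Attained q

        scanned-extend : ∀ {k q q′} → q′ ℕ.≤ q → Scanned (toℕ k) q → Attained q′ →
          (Open (cap ⟨$⟩ʳ k) → q′ ℕ.≤ position (cap ⟨$⟩ʳ k)) → Scanned (suc (toℕ k)) q′
        scanned-extend {k} q′≤q (lower , _) att new = below , att
          where
          below : ∀ j → toℕ j ℕ.< suc (toℕ k) → Open (cap ⟨$⟩ʳ j) → _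
          below j (s≤s j≤k) open-j with ℕ.m≤n⇒m<n∨m≡n j≤k
          ... | inj₁ j<k = ℕ.≤-trans q′≤q (lower j j<k open-j)
          ... | inj₂ j≡k with ≡.refl ← Fin.toℕ-injective {i = j} {j = k} j≡k = new open-j

        scanned-take : ∀ {k q} → Scanned (toℕ k) q → Open (cap ⟨$⟩ʳ k) → position (cap ⟨$⟩ʳ k) ℕ.< q →
                       Scanned (suc (toℕ k)) (position (cap ⟨$⟩ʳ k))
        scanned-take {k} sc open-k pos<q = scanned-extend {k} (ℕ.<⇒≤ pos<q) sc
          (inj₂ (σ ⟨$⟩ˡ (cap ⟨$⟩ʳ k) , ≡.refl , ≡.subst Open (≡.sym (inverseʳ σ)) open-k)) (λ _ → ℕ.≤-refl)

        scanned-skip : ∀ {k q} → Scanned (toℕ k) q → ¬ (Open (cap ⟨$⟩ʳ k) × position (cap ⟨$⟩ʳ k) ℕ.< q) →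
                       Scanned (suc (toℕ k)) q
        scanned-skip {k} sc@(_ , att) ¬both = scanned-extend {k} ℕ.≤-refl sc att
          (λ open-k → ℕ.≮⇒≥ (λ pos<q → ¬both (open-k , pos<q)))

        -- Capacities are nonincreasing along cap, so the first empty one ends the scan.
        scanned-all : ∀ {k q} → Scanned k q → (∀ (k<m : k ℕ.< m) → ¬ 0 ℕ.< b (cap ⟨$⟩ʳ fromℕ< k<m)) → First q
        scanned-all {k} {q} (lower , att) stop = below , att
          where
          below : ∀ i → Open i → q ℕ.≤ position i
          below i open-i with toℕ (cap ⟨$⟩ˡ i) ℕ.<? k
          ... | yes j<k = ≡.subst (λ i → q ℕ.≤ position i) (inverseʳ cap)
                            (lower (cap ⟨$⟩ˡ i) j<k (≡.subst Open (≡.sym (inverseʳ cap)) open-i))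
          ... | no j≮k = contradiction
            (ℕ.<-≤-trans (ℕ.≤-<-trans z≤n open-i) (≡.subst (λ i → b i ℕ.≤ b (cap ⟨$⟩ʳ fromℕ< k<m)) (inverseʳ cap) (cap-ok k≤j)))
            (stop k<m)
            where
            k<m = ℕ.≤-<-trans (ℕ.≮⇒≥ j≮k) (Fin.toℕ<n (cap ⟨$⟩ˡ i))
            k≤j : fromℕ< k<m Fin.≤ cap ⟨$⟩ˡ i
            k≤j = ℕ.≤-trans (ℕ.≤-reflexive (Fin.toℕ-fromℕ< k<m)) (ℕ.≮⇒≥ j≮k)

        -- `find` stops at the first open position, the scan at the least one. Each bounds the
        -- other, so antisymmetry identifies them.
        first-just : ∀ {q} → First q → q ℕ.< m → ∃[ j ] q ≡ toℕ j × fill I σ x ≡ just (σ ⟨$⟩ʳ j)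
        first-just (lower , inj₁ ≡.refl) q<m = contradiction q<m (ℕ.<-irrefl ≡.refl)
        first-just (lower , inj₂ (j , ≡.refl , open-j)) q<m with fill-view I σ x
        ... | inj₁ (closed , _) = contradiction open-j (closed j)
        ... | inj₂ (j′ , open-j′ , before , eq) = j , ≡.refl ,
              ≡.trans eq (≡.cong (just ∘ (σ ⟨$⟩ʳ_)) (Fin.toℕ-injective (ℕ.≤-antisym j′≤j j≤j′)))
          where
          j≤j′ : toℕ j ℕ.≤ toℕ j′
          j≤j′ = ≡.subst (λ i → toℕ j ℕ.≤ toℕ i) (inverseˡ σ) (lower _ open-j′)
          j′≤j : toℕ j′ ℕ.≤ toℕ j
          j′≤j = ℕ.≮⇒≥ λ j<j′ → before j<j′ open-j

        first-nothing : ∀ {q} → First q → ¬ q ℕ.< m → fill I σ x ≡ nothing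
        first-nothing (lower , _) q≮m with fill-view I σ x
        ... | inj₁ (_ , eq) = eq
        ... | inj₂ (j , open-j , _) =
          contradiction (ℕ.≤-<-trans (lower _ open-j) (Fin.toℕ<n (σ ⟨$⟩ˡ _))) q≮m

      record Env (P Q : ℕ) (s : Store) : Set c where
        field
          products-cell : nats s 0 0 ≡ m
          periods-cell  : nats s 0 1 ≡ T
          capacities    : ∀ i → nats s 1 (toℕ i) ≡ b i
          cap-products  : ∀ j → nats s 4 (toℕ j) ≡ toℕ (cap ⟨$⟩ʳ j)
          products      : ∀ j → nats s Q (toℕ j) ≡ toℕ (σ ⟨$⟩ʳ j)
          positions     : ∀ i → nats s P (toℕ i) ≡ position i
          base-rewards  : ∀ i → nums s 0 (toℕ i) ≡ r i
          bonus-values  : ∀ k → nums s 1 k ≡ g k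
          probabilities : ∀ t → nums s 2 t ≡ extend 0# p t

      module _ {P Q X V : ℕ} (P<6 : P ℕ.< 6) (Q<6 : Q ℕ.< 6) (6≤X : 6 ℕ.≤ X) (X<8 : X ℕ.< 8) (3≤V : 3 ℕ.≤ V) where

        env-kept : ∀ {h v s s′} → 6 ℕ.≤ h → 3 ℕ.≤ v → Keeps h v s s′ → Env P Q s → Env P Q s′
        env-kept {h} {v} {s} {s′} 6≤h 3≤v kept env = record
          { products-cell = ≡.trans (nat 0 (m≤ 0 5)) products-cell
          ; periods-cell  = ≡.trans (nat 1 (m≤ 0 5)) periods-cell
          ; capacities    = λ i → ≡.trans (nat _ (m≤ 1 4)) (capacities i)
          ; cap-products  = λ j → ≡.trans (nat _ (m≤ 4 1)) (cap-products j)
          ; products      = λ j → ≡.trans (nat _ Q<6) (products j)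
          ; positions     = λ i → ≡.trans (nat _ P<6) (positions i)
          ; base-rewards  = λ i → ≡.trans (num _ (m≤ 0 2)) (base-rewards i)
          ; bonus-values  = λ k → ≡.trans (num _ (m≤ 1 1)) (bonus-values k)
          ; probabilities = λ t → ≡.trans (num _ (m≤ 2 0)) (probabilities t)
          }
          where
          open Env env
          m≤ : ∀ a d → a ℕ.< suc (a ℕ.+ d)
          m≤ a d = s≤s (ℕ.m≤m+n a d)
          nat : ∀ {a} j → a ℕ.< 6 → nats s′ a j ≡ nats s a j
          nat j a<6 = Keeps.nats-kept kept j (ℕ.<-≤-trans a<6 6≤h)
          num : ∀ {a} j → a ℕ.< 3 → nums s′ a j ≡ nums s a j
          num j a<3 = Keeps.nums-kept kept j (ℕ.<-≤-trans a<3 3≤v)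

        Holding : Store → Vector ℕ m → Set
        Holding s x = ∀ i → nats s X (toℕ i) ≡ x i

        module _ {v s x} (3≤v : 3 ℕ.≤ v) (env : Env P Q s) (holding : Holding s x) where

          -- The fuel C - k suffices because the guard requires positive capacity at position k of
          -- `cap`, which forces k below C.
          Scanning : ℕ → Store → Set c
          Scanning n s′ = Keeps 10 v s s′ × nats s′ 10 0 ℕ.+ n ≡ C × Scanned x (nats s′ 10 0) (nats s′ 11 0)

          module _ {s′} (kept : Keeps 10 v s s′) (k<m : nats s′ 10 0 ℕ.< m) where
            open Env (env-kept (ℕ.m≤m+n 6 4) 3≤v kept env)

            at : ∀ {a} (f : Vector ℕ m) → (∀ i → nats s′ a (toℕ i) ≡ f i) →
                 nats s′ a (nats s′ 4 (nats s′ 10 0)) ≡ f (cap ⟨$⟩ʳ fromℕ< k<m)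
            at {a} f a≡f = ≡.trans (≡.cong (nats s′ a) (≡.trans
              (≡.cong (nats s′ 4) (≡.sym (Fin.toℕ-fromℕ< k<m))) (cap-products _))) (a≡f _)

            capacity-at : nats s′ 1 (nats s′ 4 (nats s′ 10 0)) ≡ b (cap ⟨$⟩ʳ fromℕ< k<m)
            capacity-at = at b capacities
            position-at : nats s′ P (nats s′ 4 (nats s′ 10 0)) ≡ position (cap ⟨$⟩ʳ fromℕ< k<m)
            position-at = at position positions
            holding-at : nats s′ X (nats s′ 4 (nats s′ 10 0)) ≡ x (cap ⟨$⟩ʳ fromℕ< k<m)
            holding-at = at x (λ i → ≡.trans (Keeps.nats-kept kept _ (ℕ.<-trans X<8 (ℕ.m≤m+n 9 1))) (holding i))

          scan-step : ∀ {n s′} → Scanning n s′ → Holds s′ scanGuard →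
            ∃[ n′ ] n ≡ suc n′ × Runs (scanBody P X) s′ 30 (Scanning n′)
          scan-step {zero} {s′} (kept , k+n≡C , sc) (lift k<m , lift 0<b) = contradiction
            (positive-prefix-cap k<m′ (≡.subst (0 ℕ.<_) (capacity-at kept k<m′) 0<b))
            (ℕ.<-irrefl (≡.trans (≡.sym (ℕ.+-identityʳ _)) k+n≡C))
            where
            k<m′ = ≡.subst (_ ℕ.<_) (Env.products-cell (env-kept (ℕ.m≤m+n 6 4) 3≤v kept env)) k<m
          scan-step {suc n} {s′} (kept , k+n≡C , sc) (lift k<m , _) = n , ≡.refl ,
            run-seq {Mid = λ s″ → Keeps 10 v s s″ × nats s″ 10 0 ≡ nats s′ 10 0 ×
                                  Scanned x (suc (nats s′ 10 0)) (nats s″ 11 0)}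
              (run-when (scanTest P X)
                (λ (lift x<b , lift pos<q) → run-nat
                  (keeps-nat 0 (ℕ.m≤m+n 10 1) kept , ≡.refl ,
                   ≡.subst₂ (Scanned x) (≡.cong suc k≡) (≡.sym (position-at kept k<m′))
                     (scanned-take x sc′
                       (≡.subst₂ ℕ._<_ (holding-at kept k<m′) (capacity-at kept k<m′) x<b)
                       (≡.subst (ℕ._< _) (position-at kept k<m′) pos<q))))
                (λ ¬both → run-≤ (s≤s z≤n) (run-skip
                  (kept , ≡.refl , ≡.subst (λ k → Scanned x k (nats s′ 11 0)) (≡.cong suc k≡)
                    (scanned-skip x sc′ λ (x<b , pos<q) → ¬both
                      ( lift (≡.subst₂ ℕ._<_ (≡.sym (holding-at kept k<m′)) (≡.sym (capacity-at kept k<m′)) x<b)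
                      , lift (≡.subst (ℕ._< _) (≡.sym (position-at kept k<m′)) pos<q)))))))
              λ (kept′ , k′≡k , sc″) → run-nat
                (keeps-nat 0 ℕ.≤-refl kept′ ,
                 ≡.trans (≡.cong (λ k → suc k ℕ.+ n) k′≡k) (≡.trans (≡.sym (ℕ.+-suc _ n)) k+n≡C) ,
                 ≡.subst (λ k → Scanned x (suc k) _) (≡.sym k′≡k) sc″)
            where
            k<m′ = ≡.subst (_ ℕ.<_) (Env.products-cell (env-kept (ℕ.m≤m+n 6 4) 3≤v kept env)) k<m
            k≡ = Fin.toℕ-fromℕ< k<m′
            sc′ : Scanned x (toℕ (fromℕ< k<m′)) (nats s′ 11 0)
            sc′ = ≡.subst (λ k → Scanned x k _) (≡.sym k≡) sc

          scan-done : ∀ {n s′} → ¬ Holds s′ scanGuard → Scanning n s′ → First x (nats s′ 11 0)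
          scan-done stop (kept , _ , sc) = scanned-all x sc λ k<m pos → stop
            ( lift (≡.subst (_ ℕ.<_) (≡.sym (Env.products-cell (env-kept (ℕ.m≤m+n 6 4) 3≤v kept env))) k<m)
            , lift (≡.subst (0 ℕ.<_) (≡.sym (capacity-at kept k<m)) pos))

          scan-runs : Runs (scan P X) s (4 ℕ.+ (3 ℕ.+ (13 ℕ.+ C ℕ.* 43)))
                           (λ s′ → Keeps 10 v s s′ × First x (nats s′ 11 0))
          scan-runs =
            run-seq {Mid = λ s′ → Keeps 10 v s s′ × nats s′ 11 0 ≡ m}
              (run-nat (keeps-nat 0 (ℕ.m≤m+n 10 1) keeps-refl , Env.products-cell env)) λ (kept , q≡m) →
            run-seq {Mid = Scanning C}
              (run-nat (keeps-nat 0 ℕ.≤-refl kept , ≡.refl , ((λ _ ()) , inj₁ q≡m))) λ inv →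
            run-map (λ (stop , n , inv′) → proj₁ inv′ , scan-done stop inv′)
              (run-while Scanning scanGuard scan-step C inv)

        -- Simulating the sales

        sell-runs : ∀ {s x n i} → Env P Q s → Holding s x → nats s 8 0 ≡ n → nats s Q (nats s 11 0) ≡ toℕ i →
          Runs (sell Q X V) s 37 (λ s′ → Keeps X V s s′ × nats s′ 8 0 ≡ suc n × nats s′ 11 0 ≡ nats s 11 0
            × Holding s′ (updateAt x i suc)
            × (∀ {j} → j ℕ.≤ n → nums s′ V j ≡ nums s V j)
            × nums s′ V (suc n) ≡ nums s V n + (r i + g (suc (x i))))
        sell-runs {s} {x} {n} {i} env holding ≡.refl i≡ =
          run-seq {Mid = _≡ s₁} (run-num ≡.refl) λ { ≡.refl →
          run-seq {Mid = _≡ s₂} (run-nat ≡.refl) λ { ≡.refl →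
          run-nat
            ( keeps-nat 0 (ℕ.<⇒≤ X<8) (keeps-nat idx ℕ.≤-refl (keeps-num (1 ℕ.+ n) ℕ.≤-refl keeps-refl))
            , ≡.cong suc (write-array idx sold (nats s) 0 (ℕ.<⇒≢ X<8))
            , write-array idx sold (nats s) 0 (ℕ.<⇒≢ (ℕ.<-trans X<8 (ℕ.m≤m+n 9 2)))
            , holding′
            , (λ j≤n → write-index V gain (nums s) (ℕ.<⇒≢ (s≤s j≤n) ∘ ≡.sym))
            , ≡.trans (write-same V (suc n) gain (nums s)) gain≡ ) } }
          where
          open Env env
          idx sold : ℕ
          idx  = nats s Q (nats s 11 0)
          sold = suc (nats s X idx)
          gain : Carrier
          gain = nums s V n + (nums s 0 idx + nums s 1 sold)
          s₁ s₂ : Store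
          s₁ = store (nats s) (write V (suc n) gain (nums s))
          s₂ = store (write X idx sold (nats s)) (nums s₁)
          sold≡ : sold ≡ suc (x i)
          sold≡ = ≡.cong suc (≡.trans (≡.cong (nats s X) i≡) (holding i))
          gain≡ : gain ≡ nums s V n + (r i + g (suc (x i)))
          gain≡ = ≡.cong (nums s V n +_) (≡.cong₂ _+_
            (≡.trans (≡.cong (nums s 0) i≡) (base-rewards i))
            (≡.trans (bonus-values sold) (≡.cong g sold≡)))
          holding′ : ∀ k → write 8 0 (suc (nats s₂ 8 0)) (nats s₂) X (toℕ k) ≡ updateAt x i suc k
          holding′ k = ≡.trans (write-array 0 _ (nats s₂) (toℕ k) (ℕ.<⇒≢ X<8 ∘ ≡.sym)) at-k
            where
            at-k : write X idx sold (nats s) X (toℕ k) ≡ updateAt x i suc k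
            at-k with i Fin.≟ k
            ... | yes ≡.refl = ≡.trans (≡.cong (write X idx sold (nats s) X) (≡.sym i≡))
                    (≡.trans (write-same X idx sold (nats s))
                    (≡.trans sold≡ (≡.sym (F.updateAt-updates i x))))
            ... | no i≢k = ≡.trans (write-index X sold (nats s) λ idx≡k →
                      i≢k (Fin.toℕ-injective (≡.trans (≡.sym i≡) idx≡k)))
                    (≡.trans (holding k) (≡.sym (F.updateAt-minimal k i x (i≢k ∘ ≡.sym))))

        -- After n sales; s is the store in which the simulation started.
        record Simulating (s : Store) (n : ℕ) (s′ : Store) : Set (c ⊔ ℓ₁) where
          field
            kept    : Keeps X V s s′
            n-cell  : nats s′ 8 0 ≡ n
            n≤T     : n ℕ.≤ T
            sold    : total (soldAfter I σ n) ≡ n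
            holding : Holding s′ (soldAfter I σ n)
            values  : ∀ {j} → j ℕ.≤ n → nums s′ V j ≈ reward I σ j
            -- Only a failed search is informative: a position below m may be that of the last sale,
            -- whose product can be full by now.
            stuck   : ¬ nats s′ 11 0 ℕ.< m → fill I σ (soldAfter I σ n) ≡ nothing

          n≤C : n ℕ.≤ C
          n≤C = ≡.subst (ℕ._≤ C) sold (total-mono (soldAfter≤b I σ n))

        module _ {s} (env : Env P Q s) where

          -- At most T and at most C sales occur, and one further search may fail, hence
          -- `T ℕ.⊓ suc C`. After a failed search q is no longer below m, so the bound lapses, as
          -- does the loop guard.
          SimulatingFor : ℕ → Store → Set (c ⊔ ℓ₁)
          SimulatingFor fuel s′ = ∃[ n ] Simulating s n s′ ×
            (nats s′ 11 0 ℕ.< m → T ℕ.⊓ suc C ℕ.≤ n ℕ.+ fuel)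

          module _ {n s′} (sim : Simulating s n s′) where
            open Simulating sim

            env′ : Env P Q s′
            env′ = env-kept 6≤X 3≤V kept env

            simulate-sell : ∀ {s″ fuel} → T ℕ.⊓ suc C ℕ.≤ suc n ℕ.+ fuel → n ℕ.< T →
              Keeps 10 (suc V) s′ s″ → First (soldAfter I σ n) (nats s″ 11 0) → nats s″ 11 0 ℕ.< m →
              Runs (sell Q X V) s″ 37 (SimulatingFor fuel)
            simulate-sell {s″} fuel-ok n<T kept′ first q<m with first-just (soldAfter I σ n) first q<m
            ... | j , q≡j , fill≡ = run-map
              (λ {s‴} (kept″ , n-cell″ , q″≡ , holding″ , old , new) → suc n , record
                { kept    = keeps-trans kept (keeps-trans
                              (keeps-≤ (ℕ.≤-trans (ℕ.<⇒≤ X<8) (ℕ.m≤m+n 8 2)) (ℕ.n≤1+n V) kept′) kept″)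
                ; n-cell  = n-cell″
                ; n≤T     = n<T
                ; sold    = ≡.trans (≡.cong total sale) (≡.trans (total-updateAt x i) (≡.cong suc sold))
                ; holding = λ k → ≡.trans (holding″ k) (≡.cong (λ x → x k) (≡.sym sale))
                ; values  = values′ {s‴} old new
                ; stuck   = λ q≮m → contradiction (≡.subst (ℕ._< m) (≡.sym q″≡) q<m) q≮m
                } , λ _ → fuel-ok)
              (sell-runs env″
                (λ k → ≡.trans (Keeps.nats-kept kept′ _ (ℕ.<-trans X<8 (ℕ.m≤m+n 9 1))) (holding k))
                (≡.trans (Keeps.nats-kept kept′ 0 (ℕ.m≤m+n 9 1)) n-cell)
                (≡.trans (≡.cong (nats s″ Q) q≡j) (Env.products env″ j)))
              where
              x = soldAfter I σ n
              i = σ ⟨$⟩ʳ j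
              env″ : Env P Q s″
              env″ = env-kept (ℕ.m≤m+n 6 4) (ℕ.≤-trans 3≤V (ℕ.n≤1+n V)) kept′ env′
              sale : soldAfter I σ (suc n) ≡ updateAt x i suc
              sale = serve-just I σ fill≡
              before : ∀ {j} → j ℕ.≤ n → nums s″ V j ≈ reward I σ j
              before {j} j≤n = trans (reflexive (Keeps.nums-kept kept′ j (ℕ.n<1+n V))) (values j≤n)
              values′ : ∀ {s‴} → (∀ {j} → j ℕ.≤ n → nums s‴ V j ≡ nums s″ V j) →
                nums s‴ V (suc n) ≡ nums s″ V n + (r i + g (suc (x i))) →
                ∀ {j} → j ℕ.≤ suc n → nums s‴ V j ≈ reward I σ j
              values′ {s‴} old new {j} j≤1+n with ℕ.m≤n⇒m<n∨m≡n j≤1+n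
              ... | inj₁ (s≤s j≤n) = trans (reflexive (old j≤n)) (before j≤n)
              ... | inj₂ ≡.refl    = trans (reflexive new) (trans (+-congʳ (before ℕ.≤-refl))
                      (trans (sym (totalReward-sale x i)) (reflexive (≡.cong (totalReward I) (≡.sym sale)))))

            simulate-skip : ∀ {s″ fuel} → Keeps 10 (suc V) s′ s″ →
              First (soldAfter I σ n) (nats s″ 11 0) → ¬ nats s″ 11 0 ℕ.< m → SimulatingFor fuel s″
            simulate-skip kept′ first q≮m = n , record
              { kept    = keeps-trans kept (keeps-≤ (ℕ.≤-trans (ℕ.<⇒≤ X<8) (ℕ.m≤m+n 8 2)) (ℕ.n≤1+n V) kept′)
              ; n-cell  = ≡.trans (Keeps.nats-kept kept′ 0 (ℕ.m≤m+n 9 1)) n-cell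
              ; n≤T     = n≤T
              ; sold    = sold
              ; holding = λ k → ≡.trans (Keeps.nats-kept kept′ _ (ℕ.<-trans X<8 (ℕ.m≤m+n 9 1))) (holding k)
              ; values  = λ {j} j≤n → trans (reflexive (Keeps.nums-kept kept′ j (ℕ.n<1+n V))) (values j≤n)
              ; stuck   = λ _ → first-nothing (soldAfter I σ n) first q≮m
              } , λ q<m → contradiction q<m q≮m

          simulate-step : ∀ {fuel s′} → SimulatingFor fuel s′ → Holds s′ simulateGuard →
            ∃[ fuel′ ] fuel ≡ suc fuel′ × Runs (simulateBody P Q X V) s′ (63 ℕ.+ C ℕ.* 43) (SimulatingFor fuel′)
          simulate-step {fuel} {s′} (n , sim , fuel-ok) (lift n<T , lift q<m) = go fuel (fuel-ok q<m′)
            where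
            open Simulating sim
            open Env (env′ sim)
            q<m′ : nats s′ 11 0 ℕ.< m
            q<m′ = ≡.subst (_ ℕ.<_) products-cell q<m
            n<T′ : n ℕ.< T
            n<T′ = ≡.subst₂ ℕ._<_ n-cell periods-cell n<T
            go : ∀ fuel → T ℕ.⊓ suc C ℕ.≤ n ℕ.+ fuel → ∃[ fuel′ ] fuel ≡ suc fuel′ ×
                 Runs (simulateBody P Q X V) s′ (63 ℕ.+ C ℕ.* 43) (SimulatingFor fuel′)
            go zero       fuel-ok = contradiction
              (ℕ.≤-trans (ℕ.⊓-glb n<T′ (s≤s n≤C)) (ℕ.≤-trans fuel-ok (ℕ.≤-reflexive (ℕ.+-identityʳ n))))
              (ℕ.<-irrefl ≡.refl)
            go (suc fuel) fuel-ok = fuel , ≡.refl , run-≤ (ℕ.≤-reflexive (ℕ.+-comm (20 ℕ.+ C ℕ.* 43) 43))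
              (run-seq (scan-runs {v = suc V} (ℕ.≤-trans 3≤V (ℕ.n≤1+n V)) (env′ sim) holding) λ {s″} (kept′ , first) →
                let m≡ = Env.products-cell (env-kept (ℕ.m≤m+n 6 4) (ℕ.≤-trans 3≤V (ℕ.n≤1+n V)) kept′ (env′ sim)) in
                run-when foundTest
                  (λ (lift found) → simulate-sell sim (≡.subst (T ℕ.⊓ suc C ℕ.≤_) (ℕ.+-suc n fuel) fuel-ok) n<T′
                                      kept′ first (≡.subst (_ ℕ.<_) m≡ found))
                  (λ ¬found → run-≤ (s≤s z≤n) (run-skip
                    (simulate-skip sim kept′ first (λ q<m → ¬found (lift (≡.subst (_ ℕ.<_) (≡.sym m≡) q<m)))))))

          Simulated : ℕ → Store → Set (c ⊔ ℓ₁)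
          Simulated n s′ = Simulating s n s′ × (n ≡ T ⊎ fill I σ (soldAfter I σ n) ≡ nothing)

          simulate-done : ∀ {fuel s′} → ¬ Holds s′ simulateGuard → SimulatingFor fuel s′ → ∃[ n ] Simulated n s′
          simulate-done {s′ = s′} stop (n , sim , _) = n , sim , end
            where
            open Simulating sim
            open Env (env′ sim)
            end : n ≡ T ⊎ fill I σ (soldAfter I σ n) ≡ nothing
            end with n ℕ.<? T | nats s′ 11 0 ℕ.<? m
            ... | no n≮T  | _       = inj₁ (ℕ.≤-antisym n≤T (ℕ.≮⇒≥ n≮T))
            ... | yes _   | no q≮m  = inj₂ (stuck q≮m)
            ... | yes n<T | yes q<m = contradiction
              (lift (≡.subst₂ ℕ._<_ (≡.sym n-cell) (≡.sym periods-cell) n<T) ,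
               lift (≡.subst (_ ℕ.<_) (≡.sym products-cell) q<m)) stop

          simulate-start : ∀ {s′} → Keeps X V s s′ → nats s′ 8 0 ≡ 0 → nats s′ 11 0 ≡ 0 → nums s′ V 0 ≡ 0# →
                           Holding s′ (λ _ → 0) → SimulatingFor (T ℕ.⊓ suc C) s′
          simulate-start kept n≡0 q≡0 v≡0 holding = 0 , record
            { kept    = kept
            ; n-cell  = n≡0
            ; n≤T     = z≤n
            ; sold    = total-0 m
            ; holding = holding
            ; values  = λ { z≤n → trans (reflexive v≡0) (sym reward-0) }
            ; stuck   = λ q≮m → no-products (λ 0<m → q≮m (≡.subst (ℕ._< m) (≡.sym q≡0) 0<m))
            } , λ _ → ℕ.≤-refl
            where
            total-0 : ∀ m → total {m} (λ _ → 0) ≡ 0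
            total-0 zero    = ≡.refl
            total-0 (suc m) = total-0 m
            reward-0 : reward I σ 0 ≈ 0#
            reward-0 = trans (sum-cong-≋ {m} (λ _ → +-identityˡ 0#)) (sum-replicate-zero m)
            no-products : ¬ 0 ℕ.< m → fill I σ (λ _ → 0) ≡ nothing
            no-products 0≮m with fill-view I σ (λ _ → 0)
            ... | inj₁ (_ , eq) = eq
            ... | inj₂ (j , _)  = contradiction (ℕ.≤-<-trans z≤n (Fin.toℕ<n j)) 0≮m

          simulate-runs : Holding s (λ _ → 0) →
            Runs (simulate P Q X V) s (21 ℕ.+ (T ℕ.⊓ suc C) ℕ.* (75 ℕ.+ C ℕ.* 43)) (λ s′ → ∃[ n ] Simulated n s′)
          simulate-runs holding =
            run-seq {Mid = _≡ s₁} (run-nat ≡.refl) λ { ≡.refl →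
            run-seq {Mid = _≡ s₂} (run-nat ≡.refl) λ { ≡.refl →
            run-seq {Mid = SimulatingFor (T ℕ.⊓ suc C)}
              (run-num (simulate-start
                (keeps-num 0 ℕ.≤-refl (keeps-nat 0 (ℕ.≤-trans (ℕ.<⇒≤ X<8) (ℕ.m≤m+n 8 3))
                  (keeps-nat 0 (ℕ.<⇒≤ X<8) keeps-refl)))
                ≡.refl ≡.refl (write-same V 0 0# (nums s))
                (λ i → ≡.trans (write-array 0 0 (nats s₁) (toℕ i) (ℕ.<⇒≢ (ℕ.<-trans X<8 (ℕ.m≤m+n 9 2)) ∘ ≡.sym))
                       (≡.trans (write-array 0 0 (nats s) (toℕ i) (ℕ.<⇒≢ X<8 ∘ ≡.sym)) (holding i))))) λ inv →
            run-map (λ (stop , fuel , inv′) → simulate-done stop inv′)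
              (run-while SimulatingFor simulateGuard simulate-step (T ℕ.⊓ suc C) inv) } }
            where
            s₁ s₂ : Store
            s₁ = store (write 8 0 0 (nats s)) (nums s)
            s₂ = store (write 11 0 0 (nats s₁)) (nums s)

        -- The backward sweep

        module _ {s′ n} (env : Env P Q s′) (n≡ : nats s′ 8 0 ≡ n) (n≤T : n ℕ.≤ T)
                 (end : n ≡ T ⊎ fill I σ (soldAfter I σ n) ≡ nothing) where

          remaining : (d t j : ℕ) → Carrier
          remaining = valueFrom (reward I σ) (extend 0# p)

          -- Why entry n is never updated. If the simulation stopped at n = T, then a time t at
          -- least n lies at the horizon. Otherwise all products are full, and later arrivals change
          -- nothing.
          remaining-end : ∀ d {t} → d ℕ.+ t ≡ T → n ℕ.≤ t → remaining d t n ≈ reward I σ n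
          remaining-end zero    _ _ = refl
          remaining-end (suc d) {t} d+t≡T n≤t = [ full , (λ stuck → valueFrom-const (reward I σ) (extend 0# p)
              (λ n≤j → reflexive (≡.cong (totalReward I) (soldAfter-stuck I σ stuck n≤j))) (suc d) t ℕ.≤-refl) ]′ end
            where
            full : n ≡ T → _
            full n≡T = contradiction
              (ℕ.≤-trans (s≤s (ℕ.≤-trans n≤t (ℕ.m≤n+m t d))) (ℕ.≤-reflexive d+t≡T)) (ℕ.<-irrefl n≡T)

          -- The restriction to j at most t keeps only states that can occur, with no more arrivals
          -- than periods elapsed. It cannot be dropped: for n = T, entry n has no reason to hold
          -- the value of an earlier period.
          Table : (d t : ℕ) → Store → Set ℓ₁
          Table d t s″ = ∀ {j} → j ℕ.≤ n → j ℕ.≤ t → nums s″ V j ≈ remaining d t j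

          Swept : ℕ → Store → Set (c ⊔ ℓ₁)
          Swept t s″ = Keeps 9 V s′ s″ × nats s″ 9 0 ≡ t × ∃[ d ] d ℕ.+ t ≡ T × Table d t s″

          module _ {d t} (1+d+t≡T : suc d ℕ.+ t ≡ T) where

            -- Within a period the array mixes two rows of the recursion, split at k. The next
            -- update reads entries k and k + 1, both still from the later row.
            record Updating (fuel : ℕ) (s″ : Store) : Set (c ⊔ ℓ₁) where
              field
                kept   : Keeps 9 V s′ s″
                t-cell : nats s″ 9 0 ≡ t
                k+fuel : nats s″ 10 0 ℕ.+ fuel ≡ n
                new    : ∀ {j} → j ℕ.< nats s″ 10 0 → j ℕ.≤ t → nums s″ V j ≈ remaining (suc d) t j
                old    : ∀ {j} → nats s″ 10 0 ℕ.≤ j → j ℕ.≤ n → j ℕ.≤ suc t →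
                         nums s″ V j ≈ remaining d (suc t) j

            update-step : ∀ {fuel s″} → Updating fuel s″ → Holds s″ (`k <ⁿ `n) →
              ∃[ fuel′ ] fuel ≡ suc fuel′ × Runs (updateEntry V) s″ 28 (Updating fuel′)
            update-step {fuel} {s″} upd (lift k<n′) = go fuel k+fuel
              where
              open Updating upd
              k : ℕ
              k = nats s″ 10 0
              k<n : k ℕ.< n
              k<n = ≡.subst (k ℕ.<_) (≡.trans (Keeps.nats-kept kept 0 ℕ.≤-refl) n≡) k<n′
              qt value : Carrier
              qt    = nums s″ 2 (nats s″ 9 0)
              value = qt * nums s″ V (suc k) + (1# - qt) * nums s″ V k
              qt≈ : qt ≈ extend 0# p t
              qt≈ = reflexive (≡.trans (≡.cong (nums s″ 2) t-cell)
                (Env.probabilities (env-kept (ℕ.m≤m+n 6 3) 3≤V kept env) t))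
              value≈ : k ℕ.≤ t → value ≈ remaining (suc d) t k
              value≈ k≤t = +-cong
                (*-cong qt≈ (old (ℕ.n≤1+n k) k<n (s≤s k≤t)))
                (*-cong (+-congˡ (-‿cong qt≈)) (old ℕ.≤-refl (ℕ.<⇒≤ k<n) (ℕ.m≤n⇒m≤1+n k≤t)))
              mem : ℕ → ℕ → Carrier
              mem = write V k value (nums s″)
              new′ : ∀ {j} → j ℕ.< suc k → j ℕ.≤ t → mem V j ≈ remaining (suc d) t j
              new′ (s≤s j≤k) j≤t with ℕ.m≤n⇒m<n∨m≡n j≤k
              ... | inj₁ j<k    = trans (reflexive (write-index V value (nums s″) (ℕ.<⇒≢ j<k ∘ ≡.sym))) (new j<k j≤t)
              ... | inj₂ ≡.refl = trans (reflexive (write-same V k value (nums s″))) (value≈ j≤t)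
              old′ : ∀ {j} → suc k ℕ.≤ j → j ℕ.≤ n → j ℕ.≤ suc t → mem V j ≈ remaining d (suc t) j
              old′ k<j j≤n j≤1+t = trans (reflexive (write-index V value (nums s″) (ℕ.<⇒≢ k<j)))
                                         (old (ℕ.<⇒≤ k<j) j≤n j≤1+t)
              go : ∀ fuel → k ℕ.+ fuel ≡ n →
                   ∃[ fuel′ ] fuel ≡ suc fuel′ × Runs (updateEntry V) s″ 28 (Updating fuel′)
              go zero       k≡n = contradiction k<n (ℕ.<-irrefl (≡.trans (≡.sym (ℕ.+-identityʳ k)) k≡n))
              go (suc fuel) k+fuel = fuel , ≡.refl ,
                run-seq {Mid = _≡ store (nats s″) mem} (run-num ≡.refl) λ { ≡.refl → run-nat record
                  { kept   = keeps-nat 0 (ℕ.n≤1+n 9) (keeps-num k ℕ.≤-refl kept)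
                  ; t-cell = t-cell
                  ; k+fuel = ≡.trans (≡.sym (ℕ.+-suc k fuel)) k+fuel
                  ; new    = new′
                  ; old    = old′
                  } }

            update-done : ∀ {fuel s″} → ¬ Holds s″ (`k <ⁿ `n) → Updating fuel s″ → Swept t s″
            update-done {fuel} {s″} stop upd = kept , t-cell , suc d , 1+d+t≡T , table
              where
              open Updating upd
              k≤n : nats s″ 10 0 ℕ.≤ n
              k≤n = ℕ.≤-trans (ℕ.m≤m+n _ fuel) (ℕ.≤-reflexive k+fuel)
              n≤k : n ℕ.≤ nats s″ 10 0
              n≤k = ℕ.≮⇒≥ λ k<n → stop (lift
                (≡.subst (_ ℕ.<_) (≡.sym (≡.trans (Keeps.nats-kept kept 0 ℕ.≤-refl) n≡)) k<n))
              table : Table (suc d) t s″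
              table {j} j≤n j≤t with ℕ.m≤n⇒m<n∨m≡n j≤n
              ... | inj₁ j<n    = new (ℕ.<-≤-trans j<n n≤k) j≤t
              -- Entry n was left alone by the loop; by `remaining-end` the two rows agree there.
              ... | inj₂ ≡.refl = trans (old k≤n ℕ.≤-refl (ℕ.m≤n⇒m≤1+n j≤t)) (trans
                      (remaining-end d (≡.trans (ℕ.+-suc d t) 1+d+t≡T) (ℕ.m≤n⇒m≤1+n j≤t))
                      (sym (remaining-end (suc d) 1+d+t≡T j≤t)))

          sweep-step : ∀ {t s″} → Swept t s″ → Holds s″ (lit 0 <ⁿ `t) →
            ∃[ t′ ] t ≡ suc t′ × Runs (sweepPeriod V) s″ (15 ℕ.+ n ℕ.* 34) (Swept t′)
          sweep-step {zero}  (_ , t≡0 , _) (lift 0<t) = contradiction 0<t (ℕ.<-irrefl (≡.sym t≡0))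
          sweep-step {suc t} {s″} (kept , t≡ , d , d+1+t≡T , table) _ = t , ≡.refl ,
            run-seq {Mid = _≡ s₁} (run-nat ≡.refl) λ { ≡.refl →
            run-seq {Mid = Updating 1+d+t≡T n} (run-nat record
              { kept   = keeps-nat 0 (ℕ.n≤1+n 9) (keeps-nat 0 ℕ.≤-refl kept)
              ; t-cell = ≡.cong (ℕ._∸ 1) t≡
              ; k+fuel = ≡.refl
              ; new    = λ ()
              ; old    = λ _ j≤n j≤1+t → table j≤n j≤1+t
              }) λ upd →
            run-map (λ (stop , fuel , upd′) → update-done 1+d+t≡T stop upd′)
              (run-while (Updating 1+d+t≡T) (`k <ⁿ `n) (update-step 1+d+t≡T) n upd) }
            where
            1+d+t≡T : suc d ℕ.+ t ≡ T
            1+d+t≡T = ≡.trans (≡.sym (ℕ.+-suc d t)) d+1+t≡T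
            s₁ : Store
            s₁ = store (write 9 0 (nats s″ 9 0 ℕ.∸ 1) (nats s″)) (nums s″)

          sweep-runs : (∀ {j} → j ℕ.≤ n → nums s′ V j ≈ reward I σ j) →
            Runs (sweep V) s′ (14 ℕ.+ T ℕ.* (n ℕ.* 54))
                 (λ s″ → Keeps 9 V s′ s″ × nums s″ V 0 ≈ remaining T 0 0)
          sweep-runs values = run-when (lit 0 <ⁿ `n)
            (λ (lift 0<n) →
              -- The fixed 20 steps of a period are charged to its n updates, which is possible
              -- because n is positive in this branch.
              run-≤ (ℕ.+-monoʳ-≤ 9 (ℕ.*-monoʳ-≤ T (cost-bound n (≡.subst (0 ℕ.<_) n≡ 0<n))))
              (run-seq {Mid = Swept T} (run-nat
                (keeps-nat 0 ℕ.≤-refl keeps-refl , Env.periods-cell env , 0 , ≡.refl , (λ j≤n _ → values j≤n))) λ inv →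
              run-map swept (run-while Swept (lit 0 <ⁿ `t) sweep-step T inv)))
            (λ 0≮n → run-≤ (s≤s z≤n) (run-skip (keeps-refl , at-0
              (ℕ.n≤0⇒n≡0 (ℕ.≮⇒≥ λ 0<n → 0≮n (lift (≡.subst (0 ℕ.<_) (≡.sym n≡) 0<n)))))))
            where
            cost-bound : ∀ n → 0 ℕ.< n → 20 ℕ.+ n ℕ.* 34 ℕ.≤ n ℕ.* 54
            cost-bound n 0<n = ℕ.≤-trans
              (ℕ.+-monoˡ-≤ (n ℕ.* 34) (ℕ.*-monoˡ-≤ 20 0<n))
              (ℕ.≤-reflexive (≡.sym (ℕ.*-distribˡ-+ n 20 34)))
            at-0 : n ≡ 0 → nums s′ V 0 ≈ remaining T 0 0
            -- With no sale, entry 0 is itself the constant entry n, so it is correct without a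
            -- sweep.
            at-0 n≡0 = trans (values z≤n) (sym (≡.subst (λ n → remaining T 0 n ≈ reward I σ n) n≡0
              (remaining-end T (ℕ.+-identityʳ T) (ℕ.≤-reflexive n≡0))))
            swept : ∀ {s″} → ¬ Holds s″ (lit 0 <ⁿ `t) × ∃[ t ] Swept t s″ →
                    Keeps 9 V s′ s″ × nums s″ V 0 ≈ remaining T 0 0
            swept (stop , zero  , kept , _ , d , d+0≡T , table) = kept ,
              ≡.subst (λ d → _ ≈ remaining d 0 0) (≡.trans (≡.sym (ℕ.+-identityʳ d)) d+0≡T) (table z≤n z≤n)
            swept (stop , suc t , _ , t≡ , _) = contradiction (lift (≡.subst (0 ℕ.<_) (≡.sym t≡) (s≤s z≤n))) stop

        -- Evaluation and selection

        evaluate-runs : ∀ {s} → Env P Q s → Holding s (λ _ → 0) →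
          Runs (evaluate P Q X V) s (suc (T ℕ.* C) ℕ.* 239)
               (λ s′ → Keeps X V s s′ × nums s′ V 0 ≈ 𝔼 I (Rev I (fill I σ)))
        evaluate-runs {s} env holding = sweep-after (simulate-runs env holding)
          where
          sweep-after : Runs (simulate P Q X V) s (21 ℕ.+ (T ℕ.⊓ suc C) ℕ.* (75 ℕ.+ C ℕ.* 43))
                             (λ s′ → ∃[ n ] Simulated env n s′) →
            Runs (evaluate P Q X V) s (suc (T ℕ.* C) ℕ.* 239)
                 (λ s′ → Keeps X V s s′ × nums s′ V 0 ≈ 𝔼 I (Rev I (fill I σ)))
          -- The cost of the sweep depends on n, a result of the simulation, while `run-seq` asks
          -- for one bound valid in every intermediate store. Fixing the final store of the
          -- simulation first makes n available; n at most C then closes the estimate.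
          sweep-after (runs {s′} {cost} simulation cost≤ (n , sim , end)) =
            run-≤ (ℕ.≤-trans (ℕ.+-monoˡ-≤ (14 ℕ.+ T ℕ.* (n ℕ.* 54)) cost≤) (evaluate-cost T C n≤C))
              (run-seq {Mid = _≡ s′} (runs simulation ℕ.≤-refl ≡.refl) then-sweep)
            where
            open Simulating sim
            then-sweep : ∀ {s″} → s″ ≡ s′ → Runs (sweep V) s″ (14 ℕ.+ T ℕ.* (n ℕ.* 54))
              (λ s″ → Keeps X V s s″ × nums s″ V 0 ≈ 𝔼 I (Rev I (fill I σ)))
            then-sweep ≡.refl = run-map
              (λ (kept′ , value) →
                keeps-trans kept (keeps-≤ (ℕ.≤-trans (ℕ.<⇒≤ X<8) (ℕ.n≤1+n 8)) ℕ.≤-refl kept′) ,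
                trans value (sym (𝔼Rev≈ I σ)))
              (sweep-runs (env′ env sim) n-cell n≤T end values)

  module _ (I : Instance) {g : ℕ → Carrier} (hom : Homogeneous I g)
           (base cap : Ordering I) (cap-ok : NonincreasingCapacity I cap) where
    open Instance I

    initial : Store
    initial = input I g base cap

    env-initial : ∀ σ {P Q} → (∀ j → nats initial Q (toℕ j) ≡ toℕ (σ ⟨$⟩ʳ j)) →
                (∀ i → nats initial P (toℕ i) ≡ toℕ (σ ⟨$⟩ˡ i)) → Env I hom cap cap-ok σ P Q initial
    env-initial σ products positions = record
      { products-cell = ≡.refl
      ; periods-cell  = ≡.refl
      ; capacities    = extend-toℕ 0 b
      ; cap-products  = extend-toℕ 0 (λ j → toℕ (cap ⟨$⟩ʳ j))
      ; products      = products
      ; positions     = positions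
      ; base-rewards  = extend-toℕ 0# r
      ; bonus-values  = λ _ → ≡.refl
      ; probabilities = λ _ → ≡.refl
      }

    env-base : Env I hom cap cap-ok base 3 2 initial
    env-base = env-initial base (extend-toℕ 0 (λ j → toℕ (base ⟨$⟩ʳ j))) (extend-toℕ 0 (λ i → toℕ (base ⟨$⟩ˡ i)))

    env-cap : Env I hom cap cap-ok cap 5 4 initial
    env-cap = env-initial cap (extend-toℕ 0 (λ j → toℕ (cap ⟨$⟩ʳ j))) (extend-toℕ 0 (λ i → toℕ (cap ⟨$⟩ˡ i)))

    Ebase Ecap : Carrier
    Ebase = 𝔼 I (Rev I (fill I base))
    Ecap  = 𝔼 I (Rev I (fill I cap))

    select-runs : let W = suc (T ℕ.* totalCapacity I) in
      Runs select initial (W ℕ.* 239 ℕ.+ (W ℕ.* 239 ℕ.+ 9))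
        (λ s → IsBetter I base cap (selected I base cap s))
    select-runs =
      run-seq (evaluate-runs I hom cap cap-ok base (ℕ.m≤m+n 4 2) (ℕ.m≤m+n 3 3)
        (ℕ.n≤1+n 6) ℕ.≤-refl ℕ.≤-refl env-base (λ _ → ≡.refl)) λ (kept , base-value) →
      run-seq (evaluate-runs I hom cap cap-ok cap ℕ.≤-refl (ℕ.n≤1+n 5)
        ℕ.≤-refl (ℕ.n≤1+n 7) (ℕ.n≤1+n 3)
        (env-kept I hom cap cap-ok cap ℕ.≤-refl (ℕ.n≤1+n 5)
          ℕ.≤-refl (ℕ.n≤1+n 7) (ℕ.n≤1+n 3) (ℕ.n≤1+n 6) ℕ.≤-refl kept env-cap)
        (λ i → Keeps.nats-kept kept (toℕ i) ℕ.≤-refl)) λ (kept′ , cap-value) →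
      let base≈ = trans (reflexive (Keeps.nums-kept kept′ 0 ℕ.≤-refl)) base-value in
      run-when (num[ 4 , lit 0 ] ≤ᵏ num[ 3 , lit 0 ])
        (λ cap≤base → run-nat (≤-refl ,
          ≤-trans (≤-reflexive (sym cap-value)) (≤-trans cap≤base (≤-reflexive base≈))))
        (λ cap≰base → run-nat
          -- A failed comparison yields the reverse inequality by totality of the order.
          ( ([ (λ le → le) , (λ le → contradiction
                (≤-trans (≤-reflexive cap-value) (≤-trans le (≤-reflexive (sym base≈)))) cap≰base) ]′
                (≤-total Ebase Ecap))
          , ≤-refl))

theorem1 : ∀ {c ℓ₁ ℓ₂} (K : OrderedField c ℓ₁ ℓ₂) → let open Model K in
    ∃[ P ] ∃[ k ]
    ((I : Instance) (f : ℕ → Carrier) → IsBonus f → Homogeneous I f →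
    (base cap : Ordering I) →
    NonincreasingBase I base → NonincreasingCapacity I cap →
    (∃[ s ] ∃[ n ] SelectsWithin P k I f base cap s n)
    × ½ * 𝔼 I (λ ω → U I (L I ω))
    ≤ max (𝔼 I (Rev I (fill I base))) (𝔼 I (Rev I (fill I cap))))
theorem1 K = select , 487 , λ I f f-bonus hom base cap base-ok cap-ok →
  let open Runs (select-runs K I hom base cap cap-ok)
      W = Model.Instance.T I ℕ.* Model.totalCapacity K I
  in (_ , _ , run , ℕ.≤-trans cost≤ (select-cost W) , post) ,
     half-approximation K I f-bonus hom base cap base-ok cap-ok
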